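{- The Secluded Path problem can be solved in polynomial time on unweighted undirected graphs of bounded (constant) maximum degree.
   Context: For $u\in V(G)$, $N[u]$ is $u$ together with its neighbors; for a subgraph $G'$, $N[G']=\bigcup_{u\in V(G')}N[u]$ and $\mathrm{Cost}(G')=|N[G']|$. Secluded Path problem: given $G$ and nodes $s,t$, find an $s$-$t$ path $P$ minimizing $\mathrm{Cost}(P)$. -}

module Defs where

open import Data.Bool.Base using (Bool; true; false; T)
open import Data.Fin.Base using (Fin; toℕ)
open import Data.Fin.Subset using (Subset; ⁅_⁆; _∪_; ⋃; ∣_∣)
open import Data.List.Base using (List; []; _∷_; foldr; head; last; map; tabulate)
open import Data.List.Relation.Unary.Linked using (Linked)
open import Data.List.Relation.Unary.Unique.Propositional using (Unique)
open import Data.Maybe.Base using (Maybe; just; nothing)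
open import Data.Nat.Base using (ℕ; zero; suc; _+_; _*_; _^_; _≤_)
open import Data.Product.Base using (∃; ∃-syntax; _×_)
import Data.Vec.Base as Vec
open import Relation.Binary.PropositionalEquality using (_≡_)
open import Relation.Nullary.Negation using (¬_)

------------------------------------------------------------------------
-- Polynomial time
--
-- The machine model is the WHILE language over binary trees (N. D. Jones,
-- "Computability and Complexity from a Programming Perspective"), in
-- variable-free form: a program transforms a single tree, and ⟨ p , q ⟩
-- runs two programs on the same input.  Every construct costs one step.
-- Representing trees by pointers to shared cells, each step takes constant
-- time, allocates at most one cell, and can inspect only whether a tree is
-- nil.  So step counts agree, up to a polynomial, with Turing machine time
-- (for results whose written-out size is polynomial in the input size).

data Tree : Set where
  nil  : Tree
  cons : Tree → Tree → Tree

size : Tree → ℕ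
size nil        = 1
size (cons x y) = 1 + size x + size y

infixr 9 _∘_

data Program : Set where
  id nil hd tl : Program
  ⟨_,_⟩         : Program → Program → Program
  _∘_           : Program → Program → Program
  if_then_else_ : Program → Program → Program → Program
  while_loop_   : Program → Program → Program

-- p [ x ]⇓ y in-time k : run on x, the program p halts with result y after
-- k steps.  As a condition, nil counts as false and every cons as true.

infix 4 _[_]⇓_in-time_

data _[_]⇓_in-time_ : Program → Tree → Tree → ℕ → Set where
  id      : ∀ {x} → id [ x ]⇓ x in-time 1
  nil     : ∀ {x} → nil [ x ]⇓ nil in-time 1
  hd-nil  : hd [ nil ]⇓ nil in-time 1
  hd-cons : ∀ {x y} → hd [ cons x y ]⇓ x in-time 1
  tl-nil  : tl [ nil ]⇓ nil in-time 1
  tl-cons : ∀ {x y} → tl [ cons x y ]⇓ y in-time 1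
  pair    : ∀ {p q x y z k l} →
            p [ x ]⇓ y in-time k →
            q [ x ]⇓ z in-time l →
            ⟨ p , q ⟩ [ x ]⇓ cons y z in-time (1 + k + l)
  comp    : ∀ {p q x y z k l} →
            q [ x ]⇓ y in-time k →
            p [ y ]⇓ z in-time l →
            p ∘ q [ x ]⇓ z in-time (1 + k + l)
  if-true : ∀ {c p q x a b y k l} →
            c [ x ]⇓ cons a b in-time k →
            p [ x ]⇓ y in-time l →
            if c then p else q [ x ]⇓ y in-time (1 + k + l)
  if-false : ∀ {c p q x y k l} →
            c [ x ]⇓ nil in-time k →
            q [ x ]⇓ y in-time l →
            if c then p else q [ x ]⇓ y in-time (1 + k + l)
  while-stop : ∀ {c p x k} →
            c [ x ]⇓ nil in-time k →
            while c loop p [ x ]⇓ x in-time (1 + k)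
  while-step : ∀ {c p x a b y z k l m} →
            c [ x ]⇓ cons a b in-time k →
            p [ x ]⇓ y in-time l →
            while c loop p [ y ]⇓ z in-time m →
            while c loop p [ x ]⇓ z in-time (1 + k + l + m)

record SearchProblem : Set₁ where
  field
    Instance       : Set
    Answer         : Instance → Set
    IsCorrect      : (i : Instance) → Answer i → Set
    encodeInstance : Instance → Tree
    encodeAnswer   : (i : Instance) → Answer i → Tree

-- A single program solves Π on all instances satisfying C, within time
-- a nᵈ + a on inputs of size n.

PolyTimeSolvableOn : (Π : SearchProblem) →
                     (SearchProblem.Instance Π → Set) → Set
PolyTimeSolvableOn Π C =
  ∃[ p ] ∃[ a ] ∃[ d ] ((i : Instance) → C i →
    ∃[ ans ] ∃[ k ]
      ( p [ encodeInstance i ]⇓ encodeAnswer i ans in-time k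
      × k ≤ a * size (encodeInstance i) ^ d + a
      × IsCorrect i ans ))
  where open SearchProblem Π

------------------------------------------------------------------------
-- Graphs

record Graph (n : ℕ) : Set where
  field
    adj    : Fin n → Fin n → Bool
    sym    : ∀ u v → adj u v ≡ adj v u
    irrefl : ∀ u → adj u u ≡ false

  Adj : Fin n → Fin n → Set
  Adj u v = T (adj u v)

  neighbours : Fin n → Subset n
  neighbours u = Vec.tabulate (adj u)

  degree : Fin n → ℕ
  degree u = ∣ neighbours u ∣

  N[_] : Fin n → Subset n
  N[ u ] = ⁅ u ⁆ ∪ neighbours u

  -- The cost of a subgraph, given by a list of its vertices.
  Cost : List (Fin n) → ℕ
  Cost us = ∣ ⋃ (map N[_] us) ∣

  record IsPath (s t : Fin n) (P : List (Fin n)) : Set where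
    field
      starts   : head P ≡ just s
      ends     : last P ≡ just t
      linked   : Linked Adj P
      distinct : Unique P

------------------------------------------------------------------------
-- The Secluded Path problem

record PathInstance : Set where
  field
    {n}   : ℕ
    graph : Graph n
    s t   : Fin n

MaxDegree≤ : ℕ → PathInstance → Set
MaxDegree≤ Δ I = ∀ u → Graph.degree graph u ≤ Δ
  where open PathInstance I

module _ (I : PathInstance) where
  open PathInstance I
  open Graph graph

  -- `nothing` reports that s and t are not connected.
  data IsSecludedPath : Maybe (List (Fin n)) → Set where
    optimal : ∀ {P} → IsPath s t P →
              (∀ Q → IsPath s t Q → Cost P ≤ Cost Q) →
              IsSecludedPath (just P)
    no-path : (∀ Q → ¬ IsPath s t Q) → IsSecludedPath nothing

encodeBool : Bool → Tree
encodeBool false = nil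
encodeBool true  = cons nil nil

-- Unary is harmless here: the only numbers encoded are vertices, and an
-- n-vertex graph is encoded by its n × n adjacency matrix.
encodeℕ : ℕ → Tree
encodeℕ zero    = nil
encodeℕ (suc m) = cons nil (encodeℕ m)

encodeList : List Tree → Tree
encodeList = foldr cons nil

encodeGraph : ∀ {n} → Graph n → Tree
encodeGraph G =
  encodeList (tabulate λ u → encodeList (tabulate λ v → encodeBool (adj u v)))
  where open Graph G

encodeVertex : ∀ {n} → Fin n → Tree
encodeVertex u = encodeℕ (toℕ u)

encodeMaybePath : ∀ {n} → Maybe (List (Fin n)) → Tree
encodeMaybePath nothing  = nil
encodeMaybePath (just P) = cons nil (encodeList (map encodeVertex P))

SecludedPath : SearchProblem
SecludedPath = record
  { Instance       = PathInstance
  ; Answer         = λ I → Maybe (List (Fin (PathInstance.n I)))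
  ; IsCorrect      = IsSecludedPath
  ; encodeInstance = λ I → let open PathInstance I in
      cons (encodeGraph graph) (cons (encodeVertex s) (encodeVertex t))
  ; encodeAnswer   = λ _ → encodeMaybePath
  }

{-# OPTIONS --safe #-}
module Submission where

open import Defs
open import Data.Bool.Base as Bool using (Bool; true; false; T; _∧_; _∨_; not)
open import Data.Bool.Properties using (T-≡)
open import Data.Fin.Base using (Fin; zero; suc; toℕ)
import Data.Fin.Properties as Fin
open import Data.Fin.Subset using (Subset; _∈_; _∉_; _⊆_; ⁅_⁆; _∪_; _∩_; ∁; ⋃; ∣_∣) renaming (⊥ to ∅; ⊤ to full)
open import Data.Fin.Subset.Properties
  using (_∈?_; ∉⊥; ∈⊤; ⊥⊆; x∈⁅x⁆; x∈⁅y⁆⇒x≡y; x∈p∪q⁻; x∈p∪q⁺; x∈p∩q⁺; x∈p∩q⁻; x∉p⇒x∈∁p; x∈∁p⇒x∉p;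
         p⊆q⇒∣p∣≤∣q∣; p⊂q⇒∣p∣<∣q∣; ∣⊥∣≡0; ∣⊤∣≡n; ∣⁅x⁆∣≡1; drop-∷-⊆)
open import Data.List.Base
  using (List; []; _∷_; _++_; _∷ʳ_; _∷ʳ′_; allFin; applyUpTo; concatMap; downFrom; drop; foldl; foldr; fromMaybe;
         head; initLast; last; length; map; replicate; reverse; tabulate; take; upTo)
open import Data.List.Membership.Propositional using (find; lose) renaming (_∈_ to _∈ˡ_)
open import Data.List.Membership.Propositional.Properties
  using (∈-++⁺ˡ; ∈-++⁺ʳ; ∈-++⁻; ∈-∃++; ∈-allFin; ∈-concatMap⁺; ∈-concatMap⁻; ∈-map⁺)
open import Data.List.NonEmpty.Base as List⁺ using (List⁺; _∷_; _∷⁺_; toList)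
open import Data.List.Properties
  using (++-assoc; ++-is-foldr; drop-drop; foldr-map; length-++; length-downFrom; length-map; length-replicate;
         length-reverse; length-tabulate; length-take; map-is-foldr; map-tabulate; map-∘; reverse-downFrom;
         reverse-foldr; reverse-involutive; tabulate-cong; take++drop≡id; take-take; ∷-injectiveʳ; ∷-injectiveˡ)
open import Data.List.Relation.Binary.Subset.Propositional using () renaming (_⊆_ to _⊆ˡ_)
open import Data.List.Relation.Unary.All as All using (All; []; _∷_)
open import Data.List.Relation.Unary.All.Properties using (¬Any⇒All¬)
open import Data.List.Relation.Unary.AllPairs using ([]; _∷_)
open import Data.List.Relation.Unary.Any using (here; there; any?)
open import Data.List.Relation.Unary.Linked using (Linked; [-]; _∷_)
open import Data.List.Relation.Unary.Unique.Propositional using (Unique)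
open import Data.Maybe.Base as Maybe using (Maybe; just; nothing; maybe′)
open import Data.Nat.Base
  using (ℕ; zero; suc; pred; _+_; _*_; _^_; _∸_; _≤_; _<_; _<ᵇ_; z≤n; s≤s; s≤s⁻¹; >-nonZero)
open import Data.Nat.GeneralisedArithmetic using (fold)
open import Data.Nat.Properties
open import Data.Product.Base as Product using (∃-syntax; _×_; _,_; proj₁; proj₂)
open import Data.Sum.Base as Sum using (_⊎_; inj₁; inj₂)
open import Data.Unit.Base using (⊤; tt)
open import Data.Vec.Base using ([]; _∷_; here; there; lookup)
open import Data.Vec.Properties
  using ([]=⇒lookup; lookup⇒[]=; lookup∘tabulate; lookup-map; lookup-replicate; lookup-zipWith)
open import Function.Base as Function using (_∘′_)
open import Function.Bundles using (Equivalence)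
open import Relation.Binary.PropositionalEquality
  using (_≡_; _≢_; refl; sym; trans; cong; cong₂; subst; module ≡-Reasoning)
open import Relation.Nullary.Decidable using (yes; no; does; _×-dec_)
open import Relation.Nullary.Negation using (¬_; contradiction)

-- Let Δ bound the degrees and D = 3 + Δ.  If two vertices of an induced walk
-- at distance more than D along the walk have a common neighbour y, then
-- rerouting the walk through y adds at most ∣N[ y ]∣ ≤ 1 + Δ vertices to the
-- closed neighbourhood and frees at least that many interior vertices.
-- Shortcuts of this kind, and along repeated vertices and chords, never
-- increase the cost, so every walk reduces to one whose neighbourhoods overlap
-- only within distance D.  For such a walk the cost is a sum of terms that
-- depend on D + 1 consecutive vertices (an upper bound on the cost for any
-- other walk), and the sum is minimised by dynamic programming over the
-- polynomially many lists of at most D vertices, layer by layer in the number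
-- of vertices.

-- Polynomial-time programs

-- Loop bounds may depend on the instance only, but the sum of the window terms has no such bound,
-- since a walk in the environment may be arbitrarily long. The program therefore works with a
-- remainder, `slack`: it starts at n and loses each term by truncated subtraction, so it stays
-- between 0 and n for every list of vertices. The truncation is harmless because no cost exceeds n.
-- The remainder is at most `n ∸ Cost W` for every W, with equality for reduced walks. Comparing
-- remainders thus never requires knowing which walks are reduced, and the dynamic program may range
-- over all walks, although its windows cannot even detect repeated vertices. In D = 3 + Δ, the part
-- 1 + Δ pays for `N[ y ]`, and the other 2 stands for the two ends of the replaced segment, which
-- may remain covered. The bound on the degrees is used a second time in the running time: lists of
-- D vertices are polynomially many only for constant D.

infix 4 _[_]⇓_within_

_[_]⇓_within_ : Program → Tree → Tree → ℕ → Set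
p [ x ]⇓ y within b = ∃[ k ] (p [ x ]⇓ y in-time k × k ≤ b)

exactly : ∀ {p x y k} → p [ x ]⇓ y in-time k → p [ x ]⇓ y within k
exactly r = _ , r , ≤-refl

relax : ∀ {p x y a b} → a ≤ b → p [ x ]⇓ y within a → p [ x ]⇓ y within b
relax a≤b (k , r , k≤a) = k , r , ≤-trans k≤a a≤b

comp-within : ∀ {p q x y z a b} → q [ x ]⇓ y within a → p [ y ]⇓ z within b →
              p ∘ q [ x ]⇓ z within (1 + a + b)
comp-within (k , r , k≤a) (l , r′ , l≤b) = _ , comp r r′ , s≤s (+-mono-≤ k≤a l≤b)

pair-within : ∀ {p q x y z a b} → p [ x ]⇓ y within a → q [ x ]⇓ z within b →
              ⟨ p , q ⟩ [ x ]⇓ cons y z within (1 + a + b)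
pair-within (k , r , k≤a) (l , r′ , l≤b) = _ , pair r r′ , s≤s (+-mono-≤ k≤a l≤b)

if-true-within : ∀ {c p q x u v y a b} → c [ x ]⇓ cons u v within a → p [ x ]⇓ y within b →
                 if c then p else q [ x ]⇓ y within (1 + a + b)
if-true-within (k , r , k≤a) (l , r′ , l≤b) = _ , if-true r r′ , s≤s (+-mono-≤ k≤a l≤b)

if-false-within : ∀ {c p q x y a b} → c [ x ]⇓ nil within a → q [ x ]⇓ y within b →
                  if c then p else q [ x ]⇓ y within (1 + a + b)
if-false-within (k , r , k≤a) (l , r′ , l≤b) = _ , if-false r r′ , s≤s (+-mono-≤ k≤a l≤b)

while-step-within : ∀ {c p x u v y z a b d} → c [ x ]⇓ cons u v within a → p [ x ]⇓ y within b →
                    while c loop p [ y ]⇓ z within d →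
                    while c loop p [ x ]⇓ z within (1 + a + b + d)
while-step-within (k , r , k≤a) (l , r′ , l≤b) (m , r″ , m≤d) =
  _ , while-step r r′ r″ , s≤s (+-mono-≤ (+-mono-≤ k≤a l≤b) m≤d)

elimList : ∀ {A B : Set} → B → (A → List A → B) → List A → B
elimList z s []       = z
elimList z s (x ∷ xs) = s x xs

size-positive : ∀ x → 1 ≤ size x
size-positive nil        = ≤-refl
size-positive (cons _ _) = s≤s z≤n

-- Γ ⊢ R ∋ f: some program computes f from an environment described by Γ.
-- Time bounds depend on the instance only, uniformly in the environment, so
-- the size of intermediate results never has to be tracked, just the number
-- of iterations of each loop.

module Computation {I : Set} (input : I → Tree) where

  weight : I → ℕ
  weight i = size (input i)

  weight^-mono : ∀ i {d e} → d ≤ e → weight i ^ d ≤ weight i ^ e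
  weight^-mono i = ^-monoʳ-≤ (weight i) ⦃ >-nonZero (size-positive (input i)) ⦄

  record Poly (B : I → ℕ) : Set where
    constructor poly
    field
      coefficient degree : ℕ
      bound : ∀ i → B i ≤ coefficient * weight i ^ degree

  poly-≤ : ∀ {A B} → (∀ i → A i ≤ B i) → Poly B → Poly A
  poly-≤ A≤B (poly b d h) = poly b d λ i → ≤-trans (A≤B i) (h i)

  poly-const : ∀ c → Poly λ _ → c
  poly-const c = poly c 0 λ i → ≤-reflexive (sym (*-identityʳ c))

  poly-weight : Poly weight
  poly-weight = poly 1 1 λ i →
    ≤-reflexive (sym (trans (*-identityˡ _) (*-identityʳ (weight i))))

  -- The weight is at least 1, so raising both monomials to the common degree `d + e` only enlarges
  -- them.
  poly-+ : ∀ {A B} → Poly A → Poly B → Poly λ i → A i + B i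
  poly-+ {A} {B} (poly a d f) (poly b e g) = poly (a + b) (d + e) λ i → begin
    A i + B i                                          ≤⟨ +-mono-≤ (f i) (g i) ⟩
    a * weight i ^ d + b * weight i ^ e
      ≤⟨ +-mono-≤ (*-monoʳ-≤ a (weight^-mono i (m≤m+n d e)))
                  (*-monoʳ-≤ b (weight^-mono i (m≤n+m e d))) ⟩
    a * weight i ^ (d + e) + b * weight i ^ (d + e)    ≡⟨ *-distribʳ-+ _ a b ⟨
    (a + b) * weight i ^ (d + e)                       ∎
    where open ≤-Reasoning

  poly-* : ∀ {A B} → Poly A → Poly B → Poly λ i → A i * B i
  poly-* {A} {B} (poly a d f) (poly b e g) = poly (a * b) (d + e) λ i → begin
    A i * B i                                  ≤⟨ *-mono-≤ (f i) (g i) ⟩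
    (a * weight i ^ d) * (b * weight i ^ e)    ≡⟨ [m*n]*[o*p]≡[m*o]*[n*p] a _ b _ ⟩
    (a * b) * (weight i ^ d * weight i ^ e)    ≡⟨ cong (a * b *_) (^-distribˡ-+-* (weight i) d e) ⟨
    (a * b) * weight i ^ (d + e)               ∎
    where open ≤-Reasoning

  -- The encoding need not be injective or follow the shape of the value: a bare counter can be
  -- encoded by the whole state of a loop, and a walk by its vertices together with data computed
  -- from them.
  record Rep : Set₁ where
    no-eta-equality
    field
      Value  : I → Set
      encode : ∀ {i} → Value i → Tree

  open Rep public

  Env : List Rep → I → Set
  Env []      i = ⊤
  Env (R ∷ Γ) i = Env Γ i × Value R i

  -- Without variables the environment is the encoded instance itself, so the input stays reachable
  -- at the bottom of every environment.
  encodeEnv : ∀ Γ {i} → Env Γ i → Tree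
  encodeEnv []      {i} _       = input i
  encodeEnv (R ∷ Γ)     (ρ , x) = cons (encode R x) (encodeEnv Γ ρ)

  infix 4 _⊢_∋_

  record _⊢_∋_ (Γ : List Rep) (R : Rep) (f : ∀ i → Env Γ i → Value R i) : Set where
    constructor term
    field
      program    : Program
      {steps}    : I → ℕ
      steps-poly : Poly steps
      runs       : ∀ i ρ → program [ encodeEnv Γ ρ ]⇓ encode R (f i ρ) within steps i

  record Bounded (Γ : List Rep) (f : ∀ i → Env Γ i → ℕ) : Set where
    constructor bounded
    field
      {limit}    : I → ℕ
      limit-poly : Poly limit
      ≤-limit    : ∀ i ρ → f i ρ ≤ limit i

  -- A program meets values only through their encodings, so functions with equal encoded results
  -- share a program. Changing the view of a datum in this way takes no steps.
  recode : ∀ {Γ R S f g} → (∀ i ρ → encode R (f i ρ) ≡ encode S (g i ρ)) →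
           Γ ⊢ R ∋ f → Γ ⊢ S ∋ g
  recode {Γ} eq (term p P r) =
    term p P λ i ρ → subst (p [ encodeEnv Γ ρ ]⇓_within _) (eq i ρ) (r i ρ)

  ext : ∀ {Γ R f g} → (∀ i ρ → f i ρ ≡ g i ρ) → Γ ⊢ R ∋ f → Γ ⊢ R ∋ g
  ext {R = R} eq = recode λ i ρ → cong (encode R) (eq i ρ)

  var : ∀ {Γ R} → R ∷ Γ ⊢ R ∋ λ _ → proj₂
  var = term hd (poly-const 1) λ i ρ → exactly hd-cons

  weaken : ∀ {Γ R S f} → Γ ⊢ R ∋ f → S ∷ Γ ⊢ R ∋ λ i ρ → f i (proj₁ ρ)
  weaken (term p P r) = term (p ∘ tl) (poly-+ (poly-const 2) P) λ i (ρ , _) →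
    comp-within (exactly tl-cons) (r i ρ)

  -- Data representations, case distinctions and loops

  Bools : Rep
  Value  Bools _ = Bool
  encode Bools   = encodeBool

  Units : Rep
  Value  Units _ = ⊤
  encode Units _ = nil

  Numbers : Rep
  Value  Numbers _ = ℕ
  encode Numbers   = encodeℕ

  Lists : Rep → Rep
  Value  (Lists R) i  = List (Value R i)
  encode (Lists R) xs = encodeList (map (encode R) xs)

  Maybes : Rep → Rep
  Value  (Maybes R) i = Maybe (Value R i)
  encode (Maybes R)   = maybe′ (λ x → cons nil (encode R x)) nil

  Pairs : Rep → Rep → Rep
  Value  (Pairs R S) i       = Value R i × Value S i
  encode (Pairs R S) (x , y) = cons (encode R x) (encode S y)

  null : ∀ {Γ R f} → (∀ i ρ → nil ≡ encode R (f i ρ)) → Γ ⊢ R ∋ f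
  null eq = recode {R = Units} {f = λ _ _ → tt} eq
    (term nil (poly-const 1) λ i ρ → exactly nil)

  construct : ∀ {Γ R S T f g h} →
              (∀ i ρ → cons (encode R (f i ρ)) (encode S (g i ρ)) ≡ encode T (h i ρ)) →
              Γ ⊢ R ∋ f → Γ ⊢ S ∋ g → Γ ⊢ T ∋ h
  construct {R = R} {S} {f = f} {g} eq (term p P r) (term q Q r′) =
    recode {R = Pairs R S} {f = λ i ρ → f i ρ , g i ρ} eq
      (term ⟨ p , q ⟩ (poly-+ (poly-+ (poly-const 1) P) Q) λ i ρ → pair-within (r i ρ) (r′ i ρ))

  first : ∀ {Γ R S f} → Γ ⊢ Pairs R S ∋ f → Γ ⊢ R ∋ λ i ρ → proj₁ (f i ρ)
  first (term p P r) = term (hd ∘ p) (poly-+ (poly-+ (poly-const 1) P) (poly-const 1)) λ i ρ →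
    comp-within (r i ρ) (exactly hd-cons)

  second : ∀ {Γ R S f} → Γ ⊢ Pairs R S ∋ f → Γ ⊢ S ∋ λ i ρ → proj₂ (f i ρ)
  second (term p P r) = term (tl ∘ p) (poly-+ (poly-+ (poly-const 1) P) (poly-const 1)) λ i ρ →
    comp-within (r i ρ) (exactly tl-cons)

  nilᵗ : ∀ {Γ R} → Γ ⊢ Lists R ∋ λ _ _ → []
  nilᵗ = null λ _ _ → refl

  nothingᵗ : ∀ {Γ R} → Γ ⊢ Maybes R ∋ λ _ _ → nothing
  nothingᵗ = null λ _ _ → refl

  justᵗ : ∀ {Γ R f} → Γ ⊢ R ∋ f → Γ ⊢ Maybes R ∋ λ i ρ → just (f i ρ)
  justᵗ {R = R} = construct {R = Units} {S = R} (λ _ _ → refl) (null λ _ _ → refl)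

  falseᵗ : ∀ {Γ} → Γ ⊢ Bools ∋ λ _ _ → false
  falseᵗ = null λ _ _ → refl

  trueᵗ : ∀ {Γ} → Γ ⊢ Bools ∋ λ _ _ → true
  trueᵗ = construct (λ _ _ → refl) falseᵗ falseᵗ

  ifᵗ : ∀ {Γ R b f g} → Γ ⊢ Bools ∋ b → Γ ⊢ R ∋ f → Γ ⊢ R ∋ g →
        Γ ⊢ R ∋ λ i ρ → Bool.if b i ρ then f i ρ else g i ρ
  ifᵗ {Γ} {R} {b} {f} {g} (term c {C} P r) (term p {A} Q s) (term q {B} Q′ s′) =
    term (if c then p else q) (poly-+ (poly-+ (poly-const 1) P) (poly-+ Q Q′)) go
    where
    go : ∀ i ρ → if c then p else q [ encodeEnv Γ ρ ]⇓ encode R (Bool.if b i ρ then f i ρ else g i ρ)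
                   within (1 + C i + (A i + B i))
    go i ρ with b i ρ | r i ρ
    ... | true  | t = if-true-within t (relax (m≤m+n (A i) (B i)) (s i ρ))
    ... | false | t = if-false-within t (relax (m≤n+m (B i) (A i)) (s′ i ρ))

  caseList : ∀ {Γ R S xs f g} → Γ ⊢ Lists R ∋ xs → Γ ⊢ S ∋ f → Lists R ∷ R ∷ Γ ⊢ S ∋ g →
             Γ ⊢ S ∋ λ i ρ → elimList (f i ρ) (λ y ys → g i ((ρ , y) , ys)) (xs i ρ)
  caseList {Γ} {R} {S} {xs} {f} {g} (term c {C} P r) (term p {A} Q s) (term q {B} Q′ s′) =
    -- A nonempty list is encoded by a `cons` and so counts as true: `c` is its own test. It is
    -- rerun for the tail and for the head, hence three times `C i` in the bound.
    term (if c then q ∘ ⟨ tl ∘ c , ⟨ hd ∘ c , id ⟩ ⟩ else p)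
         {λ i → 1 + C i + (A i + branch i)}
         (poly-+ (poly-+ (poly-const 1) P) (poly-+ Q (poly-+ (poly-+ (poly-const 1)
           (poly-+ (poly-+ (poly-const 1) (poly-+ (poly-+ (poly-const 1) P) (poly-const 1)))
             (poly-+ (poly-+ (poly-const 1) (poly-+ (poly-+ (poly-const 1) P) (poly-const 1))) (poly-const 1))))
           Q′)))
         go
    where
    branch : I → ℕ
    branch i = 1 + (1 + (1 + C i + 1) + (1 + (1 + C i + 1) + 1)) + B i

    go : ∀ i ρ → _ [ encodeEnv Γ ρ ]⇓ encode S (elimList (f i ρ) (λ y ys → g i ((ρ , y) , ys)) (xs i ρ))
                   within (1 + C i + (A i + branch i))
    go i ρ with xs i ρ | r i ρ
    ... | []     | t = if-false-within t (relax (m≤m+n (A i) (branch i)) (s i ρ))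
    ... | y ∷ ys | t = if-true-within t (relax (m≤n+m (branch i) (A i))
      (comp-within (pair-within (comp-within t (exactly tl-cons))
                                (pair-within (comp-within t (exactly hd-cons)) (exactly id)))
                   (s′ i ((ρ , y) , ys))))

  caseMaybe : ∀ {Γ R S m f g} → Γ ⊢ Maybes R ∋ m → Γ ⊢ S ∋ f → R ∷ Γ ⊢ S ∋ g →
              Γ ⊢ S ∋ λ i ρ → maybe′ (λ x → g i (ρ , x)) (f i ρ) (m i ρ)
  caseMaybe {Γ} {R} {S} {m} {f} {g} (term c {C} P r) (term p {A} Q s) (term q {B} Q′ s′) =
    term (if c then q ∘ ⟨ tl ∘ c , id ⟩ else p)
         {λ i → 1 + C i + (A i + branch i)}
         (poly-+ (poly-+ (poly-const 1) P) (poly-+ Q (poly-+ (poly-+ (poly-const 1)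
           (poly-+ (poly-+ (poly-const 1) (poly-+ (poly-+ (poly-const 1) P) (poly-const 1))) (poly-const 1)))
           Q′)))
         go
    where
    branch : I → ℕ
    branch i = 1 + (1 + (1 + C i + 1) + 1) + B i

    go : ∀ i ρ → _ [ encodeEnv Γ ρ ]⇓ encode S (maybe′ (λ x → g i (ρ , x)) (f i ρ) (m i ρ))
                   within (1 + C i + (A i + branch i))
    go i ρ with m i ρ | r i ρ
    ... | nothing | t = if-false-within t (relax (m≤m+n (A i) (branch i)) (s i ρ))
    ... | just x  | t = if-true-within t (relax (m≤n+m (branch i) (A i))
      (comp-within (pair-within (comp-within t (exactly tl-cons)) (exactly id)) (s′ i (ρ , x))))

  -- The loop runs on cons accumulator (cons remaining-items environment).
  foldlᵗ : ∀ {Γ R S xs b f} → Γ ⊢ Lists R ∋ xs → Bounded Γ (λ i ρ → length (xs i ρ)) →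
           Γ ⊢ S ∋ b → S ∷ R ∷ Γ ⊢ S ∋ f →
           Γ ⊢ S ∋ λ i ρ → foldl (λ y x → f i ((ρ , x) , y)) (b i ρ) (xs i ρ)
  foldlᵗ {Γ} {R} {S} {xs} {b} {f} (term p {A} P r) (bounded {L} PL le) (term q {B} Q s) (term body {C} PC t) =
    term (hd ∘ (loop ∘ ⟨ q , ⟨ p , id ⟩ ⟩))
         (poly-+ (poly-+ (poly-const 1)
           (poly-+ (poly-+ (poly-const 1)
              (poly-+ (poly-+ (poly-const 1) Q) (poly-+ (poly-+ (poly-const 1) P) (poly-const 1))))
             (poly-+ (poly-* PL (poly-+ (poly-+ (poly-const 4) (poly-+ (poly-+ (poly-const 1)
                (poly-+ (poly-const 12) PC)) (poly-const 9))) (poly-const 0))) (poly-const 4))))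
           (poly-const 1))
         λ i ρ → comp-within
           (comp-within (pair-within (s i ρ) (pair-within (r i ρ) (exactly id)))
                        (relax (+-monoˡ-≤ 4 (*-monoˡ-≤ (round i) (le i ρ))) (loop-runs i ρ (xs i ρ) (b i ρ))))
           (exactly hd-cons)
    where
    loop : Program
    loop = while hd ∘ tl loop ⟨ body ∘ ⟨ hd , ⟨ hd ∘ hd ∘ tl , tl ∘ tl ⟩ ⟩ , ⟨ tl ∘ hd ∘ tl , tl ∘ tl ⟩ ⟩

    -- The test and the loop construct take 4 steps, rebuilding the environment and running the body
    -- `12 + C i`, removing the used item 9, and pairing the results 1.
    round : I → ℕ
    round i = 4 + (1 + (12 + C i) + 9) + 0

    loop-runs : ∀ i ρ xs y →
      loop [ cons (encode S y) (cons (encodeList (map (encode R) xs)) (encodeEnv Γ ρ)) ]⇓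
        cons (encode S (foldl (λ y x → f i ((ρ , x) , y)) y xs)) (cons nil (encodeEnv Γ ρ))
        within (length xs * round i + 4)
    loop-runs i ρ []       y = exactly (while-stop (comp tl-cons hd-cons))
    loop-runs i ρ (x ∷ xs) y = relax
      (≤-reflexive (trans (cong (_+ (length xs * round i + 4)) (sym (+-identityʳ (4 + (1 + (12 + C i) + 9)))))
                          (sym (+-assoc (round i) (length xs * round i) 4))))
      (while-step-within (exactly (comp tl-cons hd-cons))
        (pair-within
          (comp-within (exactly (pair hd-cons (pair (comp (comp tl-cons hd-cons) hd-cons) (comp tl-cons tl-cons))))
                       (t i ((ρ , x) , y)))
          (exactly (pair (comp (comp tl-cons hd-cons) tl-cons) (comp tl-cons tl-cons))))
        (loop-runs i ρ xs (f i ((ρ , x) , y))))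

  reverseᵗ : ∀ {Γ R xs} → Γ ⊢ Lists R ∋ xs → Bounded Γ (λ i ρ → length (xs i ρ)) →
             Γ ⊢ Lists R ∋ λ i ρ → reverse (xs i ρ)
  reverseᵗ {R = R} xs len = foldlᵗ xs len nilᵗ
    (construct {S = Lists R} (λ _ _ → refl) (weaken var) var)

  -- A loop consumes a list from the front, so a right fold is run as a left fold over the reversal.
  foldrᵗ : ∀ {Γ R S xs b f} → Γ ⊢ Lists R ∋ xs → Bounded Γ (λ i ρ → length (xs i ρ)) →
           Γ ⊢ S ∋ b → S ∷ R ∷ Γ ⊢ S ∋ f →
           Γ ⊢ S ∋ λ i ρ → foldr (λ x y → f i ((ρ , x) , y)) (b i ρ) (xs i ρ)
  foldrᵗ {xs = xs} ts len tb tf =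
    ext (λ i ρ → trans (sym (reverse-foldr _ _ (reverse (xs i ρ)))) (cong (foldr _ _) (reverse-involutive (xs i ρ))))
        (foldlᵗ (reverseᵗ ts len)
          (bounded (limit-poly len) λ i ρ → ≤-trans (≤-reflexive (length-reverse (xs i ρ))) (≤-limit len i ρ)) tb tf)
    where open Bounded

  consᵗ : ∀ {Γ R x xs} → Γ ⊢ R ∋ x → Γ ⊢ Lists R ∋ xs → Γ ⊢ Lists R ∋ λ i ρ → x i ρ ∷ xs i ρ
  consᵗ {R = R} = construct {R = R} {S = Lists R} λ _ _ → refl

  appendᵗ : ∀ {Γ R xs ys} → Γ ⊢ Lists R ∋ xs → Bounded Γ (λ i ρ → length (xs i ρ)) → Γ ⊢ Lists R ∋ ys →
            Γ ⊢ Lists R ∋ λ i ρ → xs i ρ ++ ys i ρ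
  appendᵗ {xs = xs} {ys} ts len ts′ =
    ext (λ i ρ → sym (++-is-foldr (xs i ρ) (ys i ρ))) (foldrᵗ ts len ts′ (consᵗ (weaken var) var))

  mapᵗ : ∀ {Γ R S xs f} → Γ ⊢ Lists R ∋ xs → Bounded Γ (λ i ρ → length (xs i ρ)) → R ∷ Γ ⊢ S ∋ f →
         Γ ⊢ Lists S ∋ λ i ρ → map (λ x → f i (ρ , x)) (xs i ρ)
  mapᵗ {xs = xs} ts len tf =
    ext (λ i ρ → sym (map-is-foldr (xs i ρ))) (foldrᵗ ts len nilᵗ (consᵗ (weaken tf) var))

  concatMapᵗ : ∀ {Γ R S xs f} → Γ ⊢ Lists R ∋ xs → Bounded Γ (λ i ρ → length (xs i ρ)) →
               R ∷ Γ ⊢ Lists S ∋ f → Bounded (R ∷ Γ) (λ i ρ → length (f i ρ)) →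
               Γ ⊢ Lists S ∋ λ i ρ → concatMap (λ x → f i (ρ , x)) (xs i ρ)
  concatMapᵗ {xs = xs} {f} ts len tf len′ =
    ext (λ i ρ → sym (foldr-map _++_ (λ x → f i (ρ , x)) [] (xs i ρ)))
      (foldrᵗ ts len (null λ _ _ → refl)
        (appendᵗ (weaken tf) (bounded (limit-poly len′) λ i ρ → ≤-limit len′ i (proj₁ ρ)) var))
    where open Bounded

  -- Booleans, unary arithmetic and list access

  notᵗ : ∀ {Γ b} → Γ ⊢ Bools ∋ b → Γ ⊢ Bools ∋ λ i ρ → not (b i ρ)
  notᵗ {b = b} t = ext (λ i ρ → eq (b i ρ)) (ifᵗ t falseᵗ trueᵗ)
    where
    eq : ∀ x → (Bool.if x then false else true) ≡ not x
    eq false = refl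
    eq true  = refl

  andᵗ : ∀ {Γ b c} → Γ ⊢ Bools ∋ b → Γ ⊢ Bools ∋ c → Γ ⊢ Bools ∋ λ i ρ → b i ρ ∧ c i ρ
  andᵗ {b = b} {c} t u = ext (λ i ρ → eq (b i ρ) (c i ρ)) (ifᵗ t u falseᵗ)
    where
    eq : ∀ x y → (Bool.if x then y else false) ≡ x ∧ y
    eq false y = refl
    eq true  y = refl

  orᵗ : ∀ {Γ b c} → Γ ⊢ Bools ∋ b → Γ ⊢ Bools ∋ c → Γ ⊢ Bools ∋ λ i ρ → b i ρ ∨ c i ρ
  orᵗ {b = b} {c} t u = ext (λ i ρ → eq (b i ρ) (c i ρ)) (ifᵗ t trueᵗ u)
    where
    eq : ∀ x y → (Bool.if x then true else y) ≡ x ∨ y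
    eq false y = refl
    eq true  y = refl

  zeroᵗ : ∀ {Γ} → Γ ⊢ Numbers ∋ λ _ _ → 0
  zeroᵗ = null λ _ _ → refl

  sucᵗ : ∀ {Γ k} → Γ ⊢ Numbers ∋ k → Γ ⊢ Numbers ∋ λ i ρ → suc (k i ρ)
  sucᵗ = construct {R = Units} {S = Numbers} (λ _ _ → refl) (null λ _ _ → refl)

  -- `encodeℕ` writes a number as a list of that many `nil`s, so arithmetic and counted loops reduce
  -- to the list combinators.
  unary : ∀ {Γ k} → Γ ⊢ Numbers ∋ k → Γ ⊢ Lists Units ∋ λ i ρ → replicate (k i ρ) tt
  unary {k = k} = recode λ i ρ → eq (k i ρ)
    where
    eq : ∀ k → encodeℕ k ≡ encodeList (map (λ _ → nil) (replicate k tt))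
    eq zero    = refl
    eq (suc k) = cong (cons nil) (eq k)

  predᵗ : ∀ {Γ k} → Γ ⊢ Numbers ∋ k → Γ ⊢ Numbers ∋ λ i ρ → pred (k i ρ)
  predᵗ {k = k} t = recode (λ i ρ → eq (k i ρ)) (caseList (unary t) nilᵗ var)
    where
    eq : ∀ k → encodeList (map (λ _ → nil) (elimList [] (λ _ ys → ys) (replicate k tt))) ≡ encodeℕ (pred k)
    eq zero          = refl
    eq (suc zero)    = refl
    eq (suc (suc k)) = cong (cons nil) (eq (suc k))

  positiveᵗ : ∀ {Γ k} → Γ ⊢ Numbers ∋ k → Γ ⊢ Bools ∋ λ i ρ → 0 <ᵇ k i ρ
  positiveᵗ {k = k} t = ext (λ i ρ → eq (k i ρ)) (caseList (unary t) falseᵗ trueᵗ)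
    where
    eq : ∀ k → elimList false (λ _ _ → true) (replicate k tt) ≡ (0 <ᵇ k)
    eq zero    = refl
    eq (suc k) = refl

  repeatᵗ : ∀ {Γ R k b f} → Γ ⊢ Numbers ∋ k → Bounded Γ k → Γ ⊢ R ∋ b → R ∷ Γ ⊢ R ∋ f →
            Γ ⊢ R ∋ λ i ρ → fold (b i ρ) (λ y → f i (ρ , y)) (k i ρ)
  repeatᵗ {R = R} {k} {b} {f} tk (bounded P le) tb tf =
    ext (λ i ρ → eq i ρ (k i ρ))
      (foldrᵗ (unary tk) (bounded P λ i ρ → ≤-trans (≤-reflexive (length-replicate (k i ρ))) (le i ρ)) tb
        (skip tf))
    where
    skip : ∀ {Γ R S f} → S ∷ Γ ⊢ S ∋ f → S ∷ R ∷ Γ ⊢ S ∋ λ i ρ → f i (proj₁ (proj₁ ρ) , proj₂ ρ)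
    skip (term p P r) = term (p ∘ ⟨ hd , tl ∘ tl ⟩) (poly-+ (poly-const 6) P) λ i ρ →
      comp-within (exactly (pair hd-cons (comp tl-cons tl-cons))) (r i _)

    eq : ∀ i ρ k → foldr (λ _ y → f i (ρ , y)) (b i ρ) (replicate k tt) ≡ fold (b i ρ) (λ y → f i (ρ , y)) k
    eq i ρ zero    = refl
    eq i ρ (suc k) = cong (λ y → f i (ρ , y)) (eq i ρ k)

  monusᵗ : ∀ {Γ m k} → Γ ⊢ Numbers ∋ m → Γ ⊢ Numbers ∋ k → Bounded Γ k →
           Γ ⊢ Numbers ∋ λ i ρ → m i ρ ∸ k i ρ
  monusᵗ {m = m} {k} tm tk len = ext (λ i ρ → eq (m i ρ) (k i ρ)) (repeatᵗ tk len tm (predᵗ var))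
    where
    eq : ∀ m k → fold m pred k ≡ m ∸ k
    eq m zero    = refl
    eq m (suc k) = trans (cong pred (eq m k)) (pred[m∸n]≡m∸[1+n] m k)

  lessThanᵗ : ∀ {Γ m k} → Γ ⊢ Numbers ∋ m → Bounded Γ m → Γ ⊢ Numbers ∋ k →
              Γ ⊢ Bools ∋ λ i ρ → m i ρ <ᵇ k i ρ
  lessThanᵗ {m = m} {k} tm len tk = ext (λ i ρ → eq (m i ρ) (k i ρ)) (positiveᵗ (monusᵗ tk tm len))
    where
    eq : ∀ m k → (0 <ᵇ k ∸ m) ≡ (m <ᵇ k)
    eq zero    k       = refl
    eq (suc m) zero    = refl
    eq (suc m) (suc k) = eq m k

  dropᵗ : ∀ {Γ R k xs} → Γ ⊢ Numbers ∋ k → Bounded Γ k → Γ ⊢ Lists R ∋ xs →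
          Γ ⊢ Lists R ∋ λ i ρ → drop (k i ρ) (xs i ρ)
  dropᵗ {k = k} {xs} tk len txs =
    ext (λ i ρ → eq (k i ρ) (xs i ρ))
      (repeatᵗ tk len txs (ext (λ i ρ → drop-1 (proj₂ ρ)) (caseList var (null λ _ _ → refl) var)))
    where
    drop-1 : ∀ {A : Set} (xs : List A) → elimList [] (λ _ ys → ys) xs ≡ drop 1 xs
    drop-1 []       = refl
    drop-1 (x ∷ xs) = refl

    eq : ∀ {A : Set} k (xs : List A) → fold xs (drop 1) k ≡ drop k xs
    eq zero    xs = refl
    eq (suc k) xs = trans (cong (drop 1) (eq k xs))
                          (trans (drop-drop k 1 xs) (cong (λ m → drop m xs) (+-comm k 1)))

  -- Unlike in `dropᵗ`, `k` is fixed outside the program, whose text contains one case distinction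
  -- per unit of `k`. This is enough for windows, whose width depends on Δ only.
  takeᵗ : ∀ k {Γ R xs} → Γ ⊢ Lists R ∋ xs → Γ ⊢ Lists R ∋ λ i ρ → take k (xs i ρ)
  takeᵗ zero    txs = null λ _ _ → refl
  takeᵗ (suc k) {xs = xs} txs =
    ext (λ i ρ → eq (xs i ρ)) (caseList txs (null λ _ _ → refl) (consᵗ (weaken var) (takeᵗ k var)))
    where
    eq : ∀ {A : Set} (xs : List A) → elimList [] (λ y ys → y ∷ take k ys) xs ≡ take (suc k) xs
    eq []       = refl
    eq (x ∷ xs) = refl

-- Shortcuts in walks

∣p∪q∣≤∣p∣+∣q∣ : ∀ {n} (p q : Subset n) → ∣ p ∪ q ∣ ≤ ∣ p ∣ + ∣ q ∣
∣p∪q∣≤∣p∣+∣q∣ []          []          = z≤n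
∣p∪q∣≤∣p∣+∣q∣ (false ∷ p) (false ∷ q) = ∣p∪q∣≤∣p∣+∣q∣ p q
∣p∪q∣≤∣p∣+∣q∣ (false ∷ p) (true  ∷ q) =
  ≤-trans (s≤s (∣p∪q∣≤∣p∣+∣q∣ p q)) (≤-reflexive (sym (+-suc ∣ p ∣ ∣ q ∣)))
∣p∪q∣≤∣p∣+∣q∣ (true  ∷ p) (false ∷ q) = s≤s (∣p∪q∣≤∣p∣+∣q∣ p q)
∣p∪q∣≤∣p∣+∣q∣ (true  ∷ p) (true  ∷ q) = s≤s (≤-trans (∣p∪q∣≤∣p∣+∣q∣ p q) (+-monoʳ-≤ ∣ p ∣ (n≤1+n _)))

disjoint⇒∣p∣+∣q∣≤∣r∣ : ∀ {n} {p q r : Subset n} → (∀ {x} → x ∈ p → x ∉ q) → p ⊆ r → q ⊆ r →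
                       ∣ p ∣ + ∣ q ∣ ≤ ∣ r ∣
disjoint⇒∣p∣+∣q∣≤∣r∣ {p = []} {[]} {[]} _ _ _ = z≤n
disjoint⇒∣p∣+∣q∣≤∣r∣ {p = true ∷ p} {true ∷ q} disj p⊆r q⊆r = contradiction here (disj here)
disjoint⇒∣p∣+∣q∣≤∣r∣ {p = true ∷ p} {false ∷ q} {false ∷ r} disj p⊆r q⊆r with () ← p⊆r here
disjoint⇒∣p∣+∣q∣≤∣r∣ {p = true ∷ p} {false ∷ q} {true ∷ r} disj p⊆r q⊆r =
  s≤s (disjoint⇒∣p∣+∣q∣≤∣r∣ (λ x∈p x∈q → disj (there x∈p) (there x∈q)) (drop-∷-⊆ p⊆r) (drop-∷-⊆ q⊆r))
disjoint⇒∣p∣+∣q∣≤∣r∣ {p = false ∷ p} {true ∷ q} {false ∷ r} disj p⊆r q⊆r with () ← q⊆r here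
disjoint⇒∣p∣+∣q∣≤∣r∣ {p = false ∷ p} {true ∷ q} {true ∷ r} disj p⊆r q⊆r =
  ≤-trans (≤-reflexive (+-suc ∣ p ∣ ∣ q ∣))
    (s≤s (disjoint⇒∣p∣+∣q∣≤∣r∣ (λ x∈p x∈q → disj (there x∈p) (there x∈q)) (drop-∷-⊆ p⊆r) (drop-∷-⊆ q⊆r)))
disjoint⇒∣p∣+∣q∣≤∣r∣ {p = false ∷ p} {false ∷ q} {c ∷ r} disj p⊆r q⊆r =
  ≤-trans (disjoint⇒∣p∣+∣q∣≤∣r∣ (λ x∈p x∈q → disj (there x∈p) (there x∈q)) (drop-∷-⊆ p⊆r) (drop-∷-⊆ q⊆r))
    (∣r∣≤ c)
  where
  ∣r∣≤ : ∀ c → ∣ r ∣ ≤ ∣ c ∷ r ∣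
  ∣r∣≤ false = ≤-refl
  ∣r∣≤ true  = n≤1+n _

-- The entries of `xs` join `p` one at a time: each enlarges it strictly, and by uniqueness the
-- later ones stay outside. With `p` empty this bounds the length of a path; in a shortcut it counts
-- the freed vertices.
∣p∣+length≤∣q∣ : ∀ {n} {p q : Subset n} {xs} → Unique xs → p ⊆ q → All (λ x → x ∉ p × x ∈ q) xs →
                 ∣ p ∣ + length xs ≤ ∣ q ∣
∣p∣+length≤∣q∣ {p = p} [] p⊆q [] = ≤-trans (≤-reflexive (+-identityʳ ∣ p ∣)) (p⊆q⇒∣p∣≤∣q∣ p⊆q)
∣p∣+length≤∣q∣ {p = p} {q} {x ∷ xs} (x≢ ∷ unique) p⊆q ((x∉p , x∈q) ∷ rest) = begin
  ∣ p ∣ + suc (length xs)        ≡⟨ +-suc ∣ p ∣ (length xs) ⟩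
  suc ∣ p ∣ + length xs
    ≤⟨ +-monoˡ-≤ (length xs) (p⊂q⇒∣p∣<∣q∣ (p⊆p∪x , x , x∈p∪q⁺ (inj₂ (x∈⁅x⁆ x)) , x∉p)) ⟩
  ∣ p ∪ ⁅ x ⁆ ∣ + length xs      ≤⟨ ∣p∣+length≤∣q∣ unique p∪x⊆q (All.zipWith restrict (x≢ , rest)) ⟩
  ∣ q ∣                          ∎
  where
  open ≤-Reasoning
  p⊆p∪x : p ⊆ p ∪ ⁅ x ⁆
  p⊆p∪x y∈p = x∈p∪q⁺ (inj₁ y∈p)

  p∪x⊆q : p ∪ ⁅ x ⁆ ⊆ q
  p∪x⊆q y∈ with x∈p∪q⁻ p ⁅ x ⁆ y∈
  ... | inj₁ y∈p = p⊆q y∈p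
  ... | inj₂ y∈x with refl ← x∈⁅y⁆⇒x≡y x y∈x = x∈q

  restrict : ∀ {y} → x ≢ y × y ∉ p × y ∈ q → y ∉ p ∪ ⁅ x ⁆ × y ∈ q
  restrict {y} (x≢y , y∉p , y∈q) = outside , y∈q
    where
    outside : y ∉ p ∪ ⁅ x ⁆
    outside y∈ with x∈p∪q⁻ p ⁅ x ⁆ y∈
    ... | inj₁ y∈p = y∉p y∈p
    ... | inj₂ y∈x = x≢y (sym (x∈⁅y⁆⇒x≡y x y∈x))

unique-length≤n : ∀ {n} {xs : List (Fin n)} → Unique xs → length xs ≤ n
unique-length≤n {n} {xs} unique = begin
  length xs                ≡⟨ cong (_+ length xs) (∣⊥∣≡0 n) ⟨
  ∣ ∅ {n} ∣ + length xs    ≤⟨ ∣p∣+length≤∣q∣ unique ⊥⊆ (All.universal (λ x → ∉⊥ , ∈⊤) xs) ⟩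
  ∣ full {n} ∣             ≡⟨ ∣⊤∣≡n n ⟩
  n                        ∎
  where open ≤-Reasoning

module _ {A : Set} where

  unique-++⁻ˡ : ∀ (xs : List A) {ys} → Unique (xs ++ ys) → Unique xs
  unique-++⁻ˡ []       _           = []
  unique-++⁻ˡ (x ∷ xs) (x≢ ∷ u) = All.tabulate (λ y∈ → All.lookup x≢ (∈-++⁺ˡ y∈)) ∷ unique-++⁻ˡ xs u

  unique-++⁻ʳ : ∀ (xs : List A) {ys} → Unique (xs ++ ys) → Unique ys
  unique-++⁻ʳ []       u       = u
  unique-++⁻ʳ (x ∷ xs) (_ ∷ u) = unique-++⁻ʳ xs u

  ∈-drop⇒split : ∀ k {xs} {x : A} → x ∈ˡ drop k xs → ∃[ ys ] ∃[ zs ] (xs ≡ ys ++ x ∷ zs × k ≤ length ys)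
  ∈-drop⇒split zero    x∈ with ys , zs , eq ← ∈-∃++ x∈ = ys , zs , eq , z≤n
  ∈-drop⇒split (suc k) {y ∷ xs} x∈ with ys , zs , refl , k≤ ← ∈-drop⇒split k x∈ = y ∷ ys , zs , refl , s≤s k≤

module Walks {n} (G : Graph n) where
  open Graph G renaming (sym to adj-sym)

  -- Vertices may repeat: a dynamic program that sees only a window cannot enforce distinctness, so
  -- it is recovered for the final answer alone.
  data Walk : Fin n → Fin n → List (Fin n) → Set where
    [_] : ∀ u → Walk u u (u ∷ [])
    _∷_ : ∀ {u v w W} → Adj u v → Walk v w W → Walk u w (u ∷ W)

  cover : List (Fin n) → Subset n
  cover us = ⋃ (map N[_] us)

  Adj-sym : ∀ {u v} → Adj u v → Adj v u
  Adj-sym {u} {v} = subst T (adj-sym u v)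

  u∈N[u] : ∀ {u} → u ∈ N[ u ]
  u∈N[u] {u} = x∈p∪q⁺ (inj₁ (x∈⁅x⁆ u))

  Adj⇒∈N : ∀ {u v} → Adj u v → v ∈ N[ u ]
  Adj⇒∈N {u} {v} e = x∈p∪q⁺ (inj₂ (lookup⇒[]= v (neighbours u)
    (trans (lookup∘tabulate (adj u) v) (Equivalence.to T-≡ e))))

  ∈N⇒≡⊎Adj : ∀ {u v} → v ∈ N[ u ] → u ≡ v ⊎ Adj u v
  ∈N⇒≡⊎Adj {u} {v} v∈ with x∈p∪q⁻ ⁅ u ⁆ (neighbours u) v∈
  ... | inj₁ v∈u = inj₁ (sym (x∈⁅y⁆⇒x≡y u v∈u))
  ... | inj₂ v∈n = inj₂ (Equivalence.from T-≡ (trans (sym (lookup∘tabulate (adj u) v)) ([]=⇒lookup v∈n)))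

  ∈N-sym : ∀ {u v} → v ∈ N[ u ] → u ∈ N[ v ]
  ∈N-sym v∈ with ∈N⇒≡⊎Adj v∈
  ... | inj₁ refl = u∈N[u]
  ... | inj₂ e    = Adj⇒∈N (Adj-sym e)

  ∈-cover⁺ : ∀ {u us y} → u ∈ˡ us → y ∈ N[ u ] → y ∈ cover us
  ∈-cover⁺ (here refl) y∈ = x∈p∪q⁺ (inj₁ y∈)
  ∈-cover⁺ (there u∈)  y∈ = x∈p∪q⁺ (inj₂ (∈-cover⁺ u∈ y∈))

  ∈-cover⁻ : ∀ us {y} → y ∈ cover us → ∃[ u ] (u ∈ˡ us × y ∈ N[ u ])
  ∈-cover⁻ []       y∈ = contradiction y∈ ∉⊥
  ∈-cover⁻ (u ∷ us) y∈ with x∈p∪q⁻ N[ u ] (cover us) y∈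
  ... | inj₁ y∈u = u , here refl , y∈u
  ... | inj₂ y∈us with v , v∈ , y∈v ← ∈-cover⁻ us y∈us = v , there v∈ , y∈v

  cover-mono : ∀ {us vs} → us ⊆ˡ vs → cover us ⊆ cover vs
  cover-mono {us} us⊆vs y∈ with u , u∈ , y∈u ← ∈-cover⁻ us y∈ = ∈-cover⁺ (us⊆vs u∈) y∈u

  Cost-mono : ∀ {us vs} → us ⊆ˡ vs → Cost us ≤ Cost vs
  Cost-mono us⊆vs = p⊆q⇒∣p∣≤∣q∣ (cover-mono us⊆vs)

  walk-head : ∀ {u w W} → Walk u w W → head W ≡ just u
  walk-head [ _ ]   = refl
  walk-head (_ ∷ _) = refl

  walk-last : ∀ {u w W} → Walk u w W → last W ≡ just w
  walk-last [ _ ]           = refl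
  walk-last (_ ∷ [ _ ])     = refl
  walk-last (_ ∷ r@(_ ∷ _)) = walk-last r

  walk-linked : ∀ {u w W} → Walk u w W → Linked Adj W
  walk-linked [ _ ]           = [-]
  walk-linked (e ∷ [ _ ])     = e ∷ [-]
  walk-linked (e ∷ r@(_ ∷ _)) = e ∷ walk-linked r

  linked⇒walk : ∀ {u w W} → Linked Adj W → head W ≡ just u → last W ≡ just w → Walk u w W
  linked⇒walk [-]     refl refl = [ _ ]
  linked⇒walk (e ∷ l) refl eq   = e ∷ linked⇒walk l refl eq

  walk-suffix : ∀ {u w W x} → Walk u w W → x ∈ˡ W → ∃[ C ] (Walk x w C × C ⊆ˡ W × length C ≤ length W)
  walk-suffix r@([ _ ]) (here refl) = _ , r , Function.id , ≤-refl
  walk-suffix r@(_ ∷ _) (here refl) = _ , r , Function.id , ≤-refl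
  walk-suffix (_ ∷ r)   (there x∈) with C , r′ , C⊆ , C≤ ← walk-suffix r x∈ =
    C , r′ , there ∘′ C⊆ , m≤n⇒m≤1+n C≤

  walk-drop-prefix : ∀ A {u w v Z} → Walk u w (A ++ v ∷ Z) → Walk v w (v ∷ Z)
  walk-drop-prefix []          [ _ ]   = [ _ ]
  walk-drop-prefix []          (e ∷ r) = e ∷ r
  walk-drop-prefix (_ ∷ [])    (_ ∷ r) = walk-drop-prefix [] r
  walk-drop-prefix (_ ∷ b ∷ A) (_ ∷ r) = walk-drop-prefix (b ∷ A) r

  walk-splice : ∀ A {u w v Z Z′} → Walk u w (A ++ v ∷ Z) → Walk v w (v ∷ Z′) → Walk u w (A ++ v ∷ Z′)
  walk-splice []      [ _ ]   r′ = r′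
  walk-splice []      (_ ∷ _) r′ = r′
  walk-splice (_ ∷ [])    (e ∷ r) r′ = e ∷ walk-splice [] r r′
  walk-splice (_ ∷ b ∷ A) (e ∷ r) r′ = e ∷ walk-splice (b ∷ A) r r′

  -- Closed neighbourhoods rule out chords and repeated vertices in one condition.
  Induced : List (Fin n) → Set
  Induced []          = ⊤
  Induced (v ∷ [])    = ⊤
  Induced (v ∷ b ∷ B) = All (_∉ N[ v ]) B × Induced (b ∷ B)

  -- The vertex `z` between them keeps `a` and `c` at least two steps apart.
  induced-separates : ∀ X {z Y a c} → Induced (X ++ z ∷ Y) → a ∈ˡ X → c ∈ˡ Y → c ∉ N[ a ]
  induced-separates (a ∷ [])     (far , _) (here refl) c∈ = All.lookup far c∈
  induced-separates (a ∷ b ∷ X)  (far , _) (here refl) c∈ = All.lookup far (∈-++⁺ʳ X (there c∈))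
  induced-separates (_ ∷ b ∷ X)  (_ , ind) (there a∈)  c∈ = induced-separates (b ∷ X) ind a∈ c∈

  induced⇒unique : ∀ {u w W} → Walk u w W → Induced W → Unique W
  induced⇒unique [ _ ] _ = [] ∷ []
  induced⇒unique (e ∷ [ v ]) _ = (u≢v ∷ []) ∷ [] ∷ []
    where
    u≢v = λ { refl → subst T (irrefl v) e }
  induced⇒unique {u} (_∷_ {v = v} e r@(_ ∷ _)) (far , ind) =
    ((λ { refl → subst T (irrefl v) e }) ∷ All.map (λ x∉ → λ { refl → x∉ u∈N[u] }) far) ∷ induced⇒unique r ind

  -- If the tail is induced but the first vertex `u` meets a vertex `x` beyond its successor, the
  -- walk jumps from `u` to the suffix at `x`, or starts there when `u` is `x` itself. Only vertices
  -- of the old walk occur, so the cost cannot grow.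
  induced⊎shortcut : ∀ {u w W} → Walk u w W →
                     Induced W ⊎ ∃[ W′ ] (Walk u w W′ × W′ ⊆ˡ W × length W′ < length W)
  induced⊎shortcut [ _ ] = inj₁ tt
  induced⊎shortcut (e ∷ r) with induced⊎shortcut r
  ... | inj₂ (W′ , r′ , W′⊆ , W′<) =
    inj₂ (_ , e ∷ r′ , (λ { (here refl) → here refl ; (there x∈) → there (W′⊆ x∈) }) , s≤s W′<)
  induced⊎shortcut (e ∷ [ _ ]) | inj₁ ind = inj₁ ([] , tt)
  induced⊎shortcut {u} (_∷_ {v = v} {W = _ ∷ B} e (e′ ∷ r)) | inj₁ ind with any? (_∈? N[ u ]) B
  ... | no  none = inj₁ (¬Any⇒All¬ B none , ind)
  ... | yes some with x , x∈B , x∈N ← find some with C , r′ , C⊆ , C≤ ← walk-suffix r x∈B with ∈N⇒≡⊎Adj x∈N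
  ...   | inj₁ refl = inj₂ (C , r′ , (λ x∈ → there (there (C⊆ x∈))) , s≤s (m≤n⇒m≤1+n C≤))
  ...   | inj₂ e″   = inj₂
    (u ∷ C , e″ ∷ r′ , (λ { (here refl) → here refl ; (there x∈) → there (there (C⊆ x∈)) }) , s≤s (s≤s C≤))

  module _ (D : ℕ) where

    -- `drop D W` begins D + 1 steps after `v`, exactly where the window `take D W` ends that will
    -- be compared with `v`.
    Spread : List (Fin n) → Set
    Spread []      = ⊤
    Spread (v ∷ W) = All (λ x → ∀ {y} → y ∈ N[ v ] → y ∉ N[ x ]) (drop D W) × Spread W

    record Overlap (W : List (Fin n)) : Set where
      constructor meets
      field
        {A} {B} {C} : List (Fin n)
        {v} {x} {y} : Fin n
        split       : W ≡ A ++ v ∷ B ++ x ∷ C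
        distance    : D ≤ length B
        y∈N[v]      : y ∈ N[ v ]
        y∈N[x]      : y ∈ N[ x ]

    spread⊎overlap : ∀ W → Spread W ⊎ Overlap W
    spread⊎overlap []      = inj₁ tt
    spread⊎overlap (v ∷ W) with spread⊎overlap W
    ... | inj₂ (meets {A} eq D≤ y∈v y∈x) = inj₂ (meets {A = v ∷ A} (cong (v ∷_) eq) D≤ y∈v y∈x)
    ... | inj₁ spread with any? (λ x → Fin.any? λ y → (y ∈? N[ v ]) ×-dec (y ∈? N[ x ])) (drop D W)
    ...   | no  none = inj₁ (All.map (λ disj {y} y∈v y∈x → disj (y , y∈v , y∈x)) (¬Any⇒All¬ _ none) , spread)
    ...   | yes some with x , x∈ , y , y∈v , y∈x ← find some with B , C , refl , D≤ ← ∈-drop⇒split D x∈ =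
      inj₂ (meets {A = []} refl D≤ y∈v y∈x)

  module _ {Δ} (degree≤Δ : ∀ u → degree u ≤ Δ) where

    ∣N∣≤1+Δ : ∀ u → ∣ N[ u ] ∣ ≤ 1 + Δ
    ∣N∣≤1+Δ u = ≤-trans (∣p∪q∣≤∣p∣+∣q∣ ⁅ u ⁆ (neighbours u))
                        (+-mono-≤ (≤-reflexive (∣⁅x⁆∣≡1 u)) (degree≤Δ u))

    -- Replacing B by y adds at most ∣N[ y ]∣ ≤ 1 + Δ vertices to the cover,
    -- and loses all vertices of B except possibly its endpoints.
    overlap-shortcut : ∀ {u w W} → Walk u w W → Induced W → Overlap (3 + Δ) W →
                       ∃[ W′ ] (Walk u w W′ × Cost W′ ≤ Cost W × length W′ < length W)
    overlap-shortcut {u} {w} r ind (meets {A} {[]} _ () _ _)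
    overlap-shortcut {u} {w} r ind (meets {A} {b ∷ B} {C} {v} {x} {y} refl (s≤s D≤) y∈v y∈x) with initLast B
    ... | M ∷ʳ′ c = W′ , walk′ , cost′ , length′
      where
      W  = A ++ v ∷ b ∷ (M ∷ʳ c) ++ x ∷ C
      W′ = A ++ v ∷ y ∷ x ∷ C
      R  = A ++ v ∷ x ∷ C

      around-c : W ≡ (A ++ v ∷ b ∷ M) ++ c ∷ x ∷ C
      around-c = trans (cong (λ Z → A ++ v ∷ b ∷ Z) (++-assoc M (c ∷ []) (x ∷ C)))
                       (sym (++-assoc A (v ∷ b ∷ M) (c ∷ x ∷ C)))

      around-b : W ≡ (A ++ v ∷ []) ++ b ∷ (M ++ c ∷ x ∷ C)
      around-b = trans around-c (trans (++-assoc A (v ∷ b ∷ M) (c ∷ x ∷ C))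
                                       (sym (++-assoc A (v ∷ []) (b ∷ M ++ c ∷ x ∷ C))))

      around-x : W ≡ (A ++ v ∷ b ∷ (M ∷ʳ c)) ++ x ∷ C
      around-x = sym (++-assoc A (v ∷ b ∷ (M ∷ʳ c)) (x ∷ C))

      separated-b : ∀ {a z} → a ∈ˡ A ++ v ∷ [] → z ∈ˡ M ++ c ∷ x ∷ C → z ∉ N[ a ]
      separated-b = induced-separates (A ++ v ∷ []) (subst Induced around-b ind)

      separated-c : ∀ {a z} → a ∈ˡ A ++ v ∷ b ∷ M → z ∈ˡ x ∷ C → z ∉ N[ a ]
      separated-c = induced-separates (A ++ v ∷ b ∷ M) (subst Induced around-c ind)

      x∉N[v] : x ∉ N[ v ]
      x∉N[v] = separated-b (∈-++⁺ʳ A (here refl)) (∈-++⁺ʳ M (there (here refl)))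

      -- Closed neighbourhoods allow `y` to equal `v` or `x`. Either case would put `x` into
      -- `N[ v ]`, although `b` and `c` lie between them.
      v~y : Adj v y
      v~y with ∈N⇒≡⊎Adj y∈v
      ... | inj₁ refl = contradiction (∈N-sym y∈x) x∉N[v]
      ... | inj₂ e    = e

      y~x : Adj y x
      y~x with ∈N⇒≡⊎Adj y∈x
      ... | inj₁ refl = contradiction y∈v x∉N[v]
      ... | inj₂ e    = Adj-sym e

      walk′ : Walk u w W′
      walk′ = walk-splice A r
        (v~y ∷ y~x ∷ walk-drop-prefix (A ++ v ∷ b ∷ (M ∷ʳ c)) (subst (Walk u w) around-x r))

      R⊆W : R ⊆ˡ W
      R⊆W z∈ with ∈-++⁻ A z∈
      ... | inj₁ z∈A               = ∈-++⁺ˡ z∈A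
      ... | inj₂ (here refl)       = ∈-++⁺ʳ A (here refl)
      ... | inj₂ (there z∈xC)      = ∈-++⁺ʳ A (there (there (∈-++⁺ʳ (M ∷ʳ c) z∈xC)))

      -- `b` keeps `M` away from `A` and `v`, and `c` keeps it away from `x` and `C`; these two
      -- vertices are given up as buffers.
      M-fresh : ∀ {m} → m ∈ˡ M → m ∉ cover R × m ∈ cover W
      M-fresh {m} m∈M = uncovered , ∈-cover⁺ (∈-++⁺ʳ A (there (there (∈-++⁺ˡ (∈-++⁺ˡ m∈M))))) u∈N[u]
        where
        uncovered : m ∉ cover R
        uncovered m∈ with a , a∈ , m∈a ← ∈-cover⁻ R m∈ with ∈-++⁻ A a∈
        ... | inj₁ a∈A         = separated-b (∈-++⁺ˡ a∈A) (∈-++⁺ˡ m∈M) m∈a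
        ... | inj₂ (here refl) = separated-b (∈-++⁺ʳ A (here refl)) (∈-++⁺ˡ m∈M) m∈a
        ... | inj₂ (there a∈)  = separated-c (∈-++⁺ʳ A (there (there m∈M))) a∈ (∈N-sym m∈a)

      M-unique : Unique M
      M-unique = unique-++⁻ˡ M (unique-++⁻ʳ (b ∷ []) (unique-++⁻ʳ (A ++ v ∷ [])
        (subst Unique around-b (induced⇒unique r ind))))

      1+Δ≤∣M∣ : 1 + Δ ≤ length M
      1+Δ≤∣M∣ = s≤s⁻¹ (≤-trans D≤ (≤-reflexive (trans (length-++ M) (+-comm (length M) 1))))

      cover-W′ : cover W′ ⊆ N[ y ] ∪ cover R
      cover-W′ z∈ with a , a∈ , z∈a ← ∈-cover⁻ W′ z∈ with ∈-++⁻ A a∈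
      ... | inj₁ a∈A                 = x∈p∪q⁺ (inj₂ (∈-cover⁺ (∈-++⁺ˡ a∈A) z∈a))
      ... | inj₂ (here refl)         = x∈p∪q⁺ (inj₂ (∈-cover⁺ (∈-++⁺ʳ A (here refl)) z∈a))
      ... | inj₂ (there (here refl)) = x∈p∪q⁺ (inj₁ z∈a)
      ... | inj₂ (there (there a∈C)) = x∈p∪q⁺ (inj₂ (∈-cover⁺ (∈-++⁺ʳ A (there a∈C)) z∈a))

      cost′ : Cost W′ ≤ Cost W
      cost′ = begin
        Cost W′                    ≤⟨ p⊆q⇒∣p∣≤∣q∣ cover-W′ ⟩
        ∣ N[ y ] ∪ cover R ∣       ≤⟨ ∣p∪q∣≤∣p∣+∣q∣ N[ y ] (cover R) ⟩
        ∣ N[ y ] ∣ + Cost R        ≤⟨ +-monoˡ-≤ (Cost R) (≤-trans (∣N∣≤1+Δ y) 1+Δ≤∣M∣) ⟩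
        length M + Cost R          ≡⟨ +-comm (length M) (Cost R) ⟩
        Cost R + length M          ≤⟨ ∣p∣+length≤∣q∣ M-unique (cover-mono R⊆W) (All.tabulate M-fresh) ⟩
        Cost W                     ∎
        where open ≤-Reasoning

      length′ : length W′ < length W
      length′ = begin-strict
        length W′                              ≡⟨ length-++ A ⟩
        length A + (3 + length C)
          <⟨ +-monoʳ-< (length A) (s≤s (s≤s (+-monoˡ-≤ (1 + length C) (≤-trans (s≤s z≤n) D≤)))) ⟩
        length A + (2 + (length (M ∷ʳ c) + (1 + length C)))
          ≡⟨ cong (λ k → length A + (2 + k)) (length-++ (M ∷ʳ c)) ⟨
        length A + length (v ∷ b ∷ (M ∷ʳ c) ++ x ∷ C)  ≡⟨ length-++ A ⟨
        length W                               ∎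
        where open ≤-Reasoning

    record Reduced (u w : Fin n) (W : List (Fin n)) : Set where
      field
        {reduct} : List (Fin n)
        walk     : Walk u w reduct
        induced  : Induced reduct
        spread   : Spread (3 + Δ) reduct
        cost≤    : Cost reduct ≤ Cost W
        length≤  : length reduct ≤ length W

    -- An overlap shortcut may create new chords through `y`, so the reduction starts afresh after
    -- each shortcut. It ends because both kinds strictly shorten the walk; `k` bounds the remaining
    -- length.
    reduce-within : ∀ k {u w W} → length W ≤ k → Walk u w W → Reduced u w W
    reduce-via : ∀ k {u w W W′} → length W ≤ suc k → Walk u w W′ → Cost W′ ≤ Cost W →
                 length W′ < length W → Reduced u w W

    reduce-within zero    ()   [ _ ]
    reduce-within zero    ()   (_ ∷ _)
    reduce-within (suc k) {W = W} W≤ r with induced⊎shortcut r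
    ... | inj₂ (W′ , r′ , W′⊆ , W′<) = reduce-via k W≤ r′ (Cost-mono W′⊆) W′<
    ... | inj₁ ind with spread⊎overlap (3 + Δ) W
    ...   | inj₁ spread = record
      { walk = r ; induced = ind ; spread = spread ; cost≤ = ≤-refl ; length≤ = ≤-refl }
    ...   | inj₂ o with W′ , r′ , cost≤ , W′< ← overlap-shortcut r ind o = reduce-via k W≤ r′ cost≤ W′<

    reduce-via k W≤ r′ cost≤ W′< = record
      { walk = R.walk ; induced = R.induced ; spread = R.spread
      ; cost≤ = ≤-trans R.cost≤ cost≤ ; length≤ = ≤-trans R.length≤ (<⇒≤ W′<) }
      where module R = Reduced (reduce-within k (s≤s⁻¹ (≤-trans W′< W≤)) r′)

    reduce : ∀ {u w W} → Walk u w W → Reduced u w W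
    reduce = reduce-within _ ≤-refl

  -- Slack, pruning and the dynamic program

  module _ (d : ℕ) where

    -- A nonempty window determines the first vertex of the walk, which decides what may be
    -- prepended and whether the walk starts at `s`.
    window : ℕ
    window = suc d

    fresh : Fin n → List (Fin n) → Subset n
    fresh v us = N[ v ] ∩ ∁ (cover us)

    -- What remains of a budget of n when each vertex pays for the part of its
    -- neighbourhood that is not covered by the window of vertices after it.
    slack : List (Fin n) → ℕ
    slack []      = n
    slack (v ∷ W) = slack W ∸ ∣ fresh v (take window W) ∣

    slack≤n : ∀ W → slack W ≤ n
    slack≤n []      = ≤-refl
    slack≤n (v ∷ W) = ≤-trans (m∸n≤m (slack W) ∣ fresh v (take window W) ∣) (slack≤n W)

    Cost≤n : ∀ W → Cost W ≤ n
    Cost≤n W = ≤-trans (p⊆q⇒∣p∣≤∣q∣ {p = cover W} {full} (λ _ → ∈⊤)) (≤-reflexive (∣⊤∣≡n n))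

    take⊆ : ∀ k {W : List (Fin n)} → take k W ⊆ˡ W
    take⊆ (suc k) {_ ∷ W} (here eq)  = here eq
    take⊆ (suc k) {_ ∷ W} (there x∈) = there (take⊆ k x∈)

    -- The window covers no more than `W` does, so `F` contains everything that `N[ v ]` adds to the
    -- cover of `W`: the charge never undercounts.
    slack≤n∸Cost : ∀ W → slack W ≤ n ∸ Cost W
    slack≤n∸Cost []      = ≤-reflexive (sym (cong (n ∸_) (∣⊥∣≡0 n)))
    slack≤n∸Cost (v ∷ W) = begin
      slack W ∸ ∣ F ∣         ≤⟨ ∸-monoˡ-≤ ∣ F ∣ (slack≤n∸Cost W) ⟩
      n ∸ Cost W ∸ ∣ F ∣      ≡⟨ ∸-+-assoc n (Cost W) ∣ F ∣ ⟩
      n ∸ (Cost W + ∣ F ∣)    ≤⟨ ∸-monoʳ-≤ n (≤-trans (p⊆q⇒∣p∣≤∣q∣ covered) (∣p∪q∣≤∣p∣+∣q∣ (cover W) F)) ⟩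
      n ∸ Cost (v ∷ W)        ∎
      where
      open ≤-Reasoning
      F = fresh v (take window W)

      covered : cover (v ∷ W) ⊆ cover W ∪ F
      covered {y} y∈ with x∈p∪q⁻ N[ v ] (cover W) y∈ | y ∈? cover (take window W)
      ... | inj₂ y∈W | _        = x∈p∪q⁺ (inj₁ y∈W)
      ... | inj₁ _   | yes y∈W  = x∈p∪q⁺ (inj₁ (cover-mono {take window W} {W} (take⊆ window) y∈W))
      ... | inj₁ y∈v | no  y∉   = x∈p∪q⁺ (inj₂ (x∈p∩q⁺ (y∈v , x∉p⇒x∈∁p y∉)))

    ∈⇒∈-take⊎∈-drop : ∀ k {W : List (Fin n)} {x} → x ∈ˡ W → x ∈ˡ take k W ⊎ x ∈ˡ drop k W
    ∈⇒∈-take⊎∈-drop k {W} x∈ = ∈-++⁻ (take k W) (subst (_ ∈ˡ_) (sym (take++drop≡id k W)) x∈)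

    -- In a spread walk a vertex of `N[ v ]` missed by the window is missed by the rest of `W` too,
    -- so nothing is charged twice.
    n∸Cost≤slack : ∀ W → Spread window W → n ∸ Cost W ≤ slack W
    n∸Cost≤slack []      _                = m∸n≤m n (Cost [])
    n∸Cost≤slack (v ∷ W) (apart , spread) = begin
      n ∸ Cost (v ∷ W)        ≤⟨ ∸-monoʳ-≤ n (disjoint⇒∣p∣+∣q∣≤∣r∣ disjoint (λ y∈ → x∈p∪q⁺ (inj₂ y∈))
                                                (λ y∈ → x∈p∪q⁺ (inj₁ (proj₁ (x∈p∩q⁻ _ _ y∈))))) ⟩
      n ∸ (Cost W + ∣ F ∣)    ≡⟨ ∸-+-assoc n (Cost W) ∣ F ∣ ⟨
      n ∸ Cost W ∸ ∣ F ∣      ≤⟨ ∸-monoˡ-≤ ∣ F ∣ (n∸Cost≤slack W spread) ⟩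
      slack W ∸ ∣ F ∣         ∎
      where
      open ≤-Reasoning
      F = fresh v (take window W)

      disjoint : ∀ {y} → y ∈ cover W → y ∉ F
      disjoint y∈W y∈F with y∈v , y∉ ← x∈p∩q⁻ N[ v ] _ y∈F
                       with u , u∈ , y∈u ← ∈-cover⁻ W y∈W
                       with ∈⇒∈-take⊎∈-drop window u∈
      ... | inj₁ u∈take = x∈∁p⇒x∉p y∉ (∈-cover⁺ u∈take y∈u)
      ... | inj₂ u∈drop = All.lookup apart u∈drop y∈v y∈u

    slack⁺ : List⁺ (Fin n) → ℕ
    slack⁺ w = slack (toList w)

    better : List⁺ (Fin n) → Maybe (List⁺ (Fin n)) → Bool
    better w = maybe′ (λ w′ → slack⁺ w′ <ᵇ slack⁺ w) true

    -- The comparison is strict, so the initial candidate wins ties. Passing on the winner of the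
    -- shorter walks thus makes short walks win.
    select : (List⁺ (Fin n) → Bool) → Maybe (List⁺ (Fin n)) → List (List⁺ (Fin n)) → Maybe (List⁺ (Fin n))
    select p = foldr λ w best → Bool.if p w ∧ better w best then just w else best

    infix 4 _≼_

    -- The preorder by slack, with `nothing` at the bottom.
    _≼_ : Maybe (List⁺ (Fin n)) → Maybe (List⁺ (Fin n)) → Set
    m ≼ m′ = ∀ {w} → m ≡ just w → ∃[ w′ ] (m′ ≡ just w′ × slack⁺ w ≤ slack⁺ w′)

    ≼-refl : ∀ {m} → m ≼ m
    ≼-refl eq = _ , eq , ≤-refl

    ≼-trans : ∀ {m m′ m″} → m ≼ m′ → m′ ≼ m″ → m ≼ m″
    ≼-trans m≼ m′≼ eq with _ , eq′ , le ← m≼ eq with _ , eq″ , le′ ← m′≼ eq′ = _ , eq″ , ≤-trans le le′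

    better⇒≼ : ∀ w m → T (better w m) → m ≼ just w
    better⇒≼ w (just w′) lt refl = w , refl , <⇒≤ (<ᵇ⇒< (slack⁺ w′) (slack⁺ w) lt)

    ¬better⇒≼ : ∀ w m → ¬ T (better w m) → just w ≼ m
    ¬better⇒≼ w nothing   ¬lt _    = contradiction tt ¬lt
    ¬better⇒≼ w (just w′) ¬lt refl = w′ , refl , ≮⇒≥ (λ lt → ¬lt (<⇒<ᵇ lt))

    choose : Bool → List⁺ (Fin n) → Maybe (List⁺ (Fin n)) → Maybe (List⁺ (Fin n))
    choose b w best = Bool.if b ∧ better w best then just w else best

    choose-≼ : ∀ b w m → m ≼ choose b w m
    choose-≼ false w m = ≼-refl
    choose-≼ true  w m with better w m | better⇒≼ w m
    ... | true  | le = le tt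
    ... | false | _  = ≼-refl

    choose-≽ : ∀ w m → just w ≼ choose true w m
    choose-≽ w m with better w m | ¬better⇒≼ w m
    ... | true  | _  = ≼-refl
    ... | false | le = le Function.id

    select-≼ : ∀ p m ws → m ≼ select p m ws
    select-≼ p m []       = ≼-refl
    select-≼ p m (w ∷ ws) = ≼-trans (select-≼ p m ws) (choose-≼ (p w) w _)

    select-complete : ∀ p m {w ws} → w ∈ˡ ws → p w ≡ true → just w ≼ select p m ws
    select-complete p m {w} {w ∷ ws} (here refl) pw rewrite pw = choose-≽ w (select p m ws)
    select-complete p m {ws = w′ ∷ ws} (there w∈) pw =
      ≼-trans (select-complete p m w∈ pw) (choose-≼ (p w′) w′ _)

    -- A winner from `ws` has beaten the best of the entries after it, which is already at least as
    -- good as `m`; hence it strictly improves on `m`.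
    select-sound : ∀ p m ws {w} → select p m ws ≡ just w →
                   m ≡ just w ⊎ (w ∈ˡ ws × p w ≡ true × T (better w m))
    select-sound p m []       eq = inj₁ eq
    select-sound p m (w′ ∷ ws) eq with p w′ in pw | better w′ (select p m ws) in lt
    ... | false | _     = Sum.map₂ (Product.map₁ there) (select-sound p m ws eq)
    ... | true  | false = Sum.map₂ (Product.map₁ there) (select-sound p m ws eq)
    ... | true  | true with refl ← eq = inj₂ (here refl , pw , improves m (select-≼ p m ws))
      where
      improves : ∀ m₀ → m₀ ≼ select p m ws → T (better w′ m₀)
      improves nothing   _  = tt
      improves (just w₀) le with w₁ , eq₁ , le₁ ← le refl =
        <⇒<ᵇ (≤-<-trans le₁ (<ᵇ⇒< (slack⁺ w₁) (slack⁺ w′)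
          (subst (λ m → T (better w′ m)) eq₁ (subst T (sym lt) tt))))

    agree : ℕ → List (Fin n) → List (Fin n) → Bool
    agree zero    _        _        = true
    agree (suc k) []       []       = true
    agree (suc k) []       (_ ∷ _)  = false
    agree (suc k) (_ ∷ _)  []       = false
    agree (suc k) (x ∷ xs) (y ∷ ys) = does (x Fin.≟ y) ∧ agree k xs ys

    agree⇒≡ : ∀ k xs ys → agree k xs ys ≡ true → take k xs ≡ take k ys
    agree⇒≡ zero    _        _        _  = refl
    agree⇒≡ (suc k) []       []       _  = refl
    agree⇒≡ (suc k) (x ∷ xs) (y ∷ ys) eq with x Fin.≟ y
    ... | yes refl = cong (x ∷_) (agree⇒≡ k xs ys eq)

    ≡⇒agree : ∀ k xs ys → take k xs ≡ take k ys → agree k xs ys ≡ true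
    ≡⇒agree zero    _        _        _  = refl
    ≡⇒agree (suc k) []       []       _  = refl
    ≡⇒agree (suc k) (x ∷ xs) (y ∷ ys) eq with x Fin.≟ y
    ... | yes _ = ≡⇒agree k xs ys (∷-injectiveʳ eq)
    ... | no x≢y = contradiction (∷-injectiveˡ eq) x≢y

    -- Shorter lists are included for walks with fewer vertices than the window.
    keys : ℕ → List (List (Fin n))
    keys zero    = [] ∷ []
    keys (suc k) = [] ∷ concatMap (λ v → map (v ∷_) (keys k)) (allFin n)

    ∈-keys : ∀ k xs → length xs ≤ k → xs ∈ˡ keys k
    ∈-keys zero    []       _        = here refl
    ∈-keys (suc k) []       _        = here refl
    ∈-keys (suc k) (x ∷ xs) (s≤s le) =
      there (∈-concatMap⁺ _ (lose (∈-allFin x) (∈-map⁺ (x ∷_) (∈-keys k xs le))))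

    extend : List (List⁺ (Fin n)) → List (List⁺ (Fin n))
    extend = concatMap λ w → concatMap (λ v → Bool.if adj v (List⁺.head w) then (v ∷⁺ w) ∷ [] else []) (allFin n)

    ∈-extend⁺ : ∀ {v w ws} → w ∈ˡ ws → Adj v (List⁺.head w) → v ∷⁺ w ∈ˡ extend ws
    ∈-extend⁺ {v} {w} w∈ e = ∈-concatMap⁺ _ (lose w∈ (∈-concatMap⁺ _ (lose (∈-allFin v) chosen)))
      where
      chosen : v ∷⁺ w ∈ˡ (Bool.if adj v (List⁺.head w) then (v ∷⁺ w) ∷ [] else [])
      chosen with true ← adj v (List⁺.head w) = here refl

    ∈-extend⁻ : ∀ ws {w′} → w′ ∈ˡ extend ws →
                ∃[ v ] ∃[ w ] (w ∈ˡ ws × Adj v (List⁺.head w) × w′ ≡ v ∷⁺ w)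
    ∈-extend⁻ ws w′∈ with w , w∈ , w′∈ ← find (∈-concatMap⁻ _ {xs = ws} w′∈)
                     with v , _ , w′∈ ← find (∈-concatMap⁻ _ {xs = allFin n} w′∈)
                     with adj v (List⁺.head w) in e | w′∈
    ... | true | here refl = v , w , w∈ , subst T (sym e) tt , refl

    -- One walk per key is enough, because the charge of any later vertex sees the walk only through
    -- its window.
    prune : List (List⁺ (Fin n)) → List (List⁺ (Fin n))
    prune ws =
      concatMap (λ key → fromMaybe (select (λ w → agree window key (toList w)) nothing ws)) (keys window)

    ∈-fromMaybe⁻ : ∀ {A : Set} {m : Maybe A} {x} → x ∈ˡ fromMaybe m → m ≡ just x
    ∈-fromMaybe⁻ {m = just _} (here refl) = refl

    prune⊆ : ∀ ws {w} → w ∈ˡ prune ws → w ∈ˡ ws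
    prune⊆ ws w∈ with key , _ , w∈ ← find (∈-concatMap⁻ _ {xs = keys window} w∈)
                 with select-sound _ nothing ws (∈-fromMaybe⁻ w∈)
    ... | inj₂ (w∈ws , _) = w∈ws

    prune-complete : ∀ {w ws} → w ∈ˡ ws → ∃[ w′ ] (w′ ∈ˡ prune ws
                     × take window (toList w′) ≡ take window (toList w) × slack⁺ w ≤ slack⁺ w′)
    prune-complete {w} {ws} w∈ = result
      where
      key = take window (toList w)

      take-key : take window key ≡ key
      take-key = trans (take-take window window (toList w)) (cong (λ k → take k (toList w)) (⊓-idem window))

      key∈ : key ∈ˡ keys window
      key∈ = ∈-keys window key (≤-trans (≤-reflexive (length-take window (toList w))) (m⊓n≤m window _))

      result : _
      result with w′ , eq , le ← select-complete _ nothing w∈ (≡⇒agree window key (toList w) take-key) refl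
             with select-sound _ nothing ws eq
      ... | inj₂ (_ , agrees , _) =
        w′ , ∈-concatMap⁺ _ (lose key∈ (subst (λ m → w′ ∈ˡ fromMaybe m) (sym eq) (here refl)))
           , trans (sym (agree⇒≡ window key (toList w′) agrees)) take-key , le

    module _ (s t : Fin n) where

      -- Walks grow backwards from `t`, because a vertex is charged against the window that follows
      -- it.
      layer : ℕ → List (List⁺ (Fin n))
      layer zero    = (t ∷ []) ∷ []
      layer (suc l) = prune (extend (layer l))

      starts-at-s : List⁺ (Fin n) → Bool
      starts-at-s w = does (List⁺.head w Fin.≟ s)

      -- The first walk of maximal slack, hence the shortest: this is what makes
      -- it a path.
      best : ℕ → Maybe (List⁺ (Fin n))
      best zero    = nothing
      best (suc l) = select starts-at-s (best l) (layer l)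

      layer-sound : ∀ l {w} → w ∈ˡ layer l → Walk (List⁺.head w) t (toList w) × length (toList w) ≡ suc l
      layer-sound zero (here refl) = [ t ] , refl
      layer-sound (suc l) w∈ with v , w , w∈ , e , refl ← ∈-extend⁻ (layer l) (prune⊆ (extend (layer l)) w∈)
                             with r , len ← layer-sound l w∈ = e ∷ r , cong suc len

      ≟-true : ∀ {u v : Fin n} → does (u Fin.≟ v) ≡ true → u ≡ v
      ≟-true {u} {v} eq with yes u≡v ← u Fin.≟ v = u≡v

      ≟-refl : ∀ (u : Fin n) → does (u Fin.≟ u) ≡ true
      ≟-refl u with u Fin.≟ u
      ... | yes _  = refl
      ... | no u≢u = contradiction refl u≢u

      head-≡ : ∀ {u w W} → Walk u t W → take window (toList w) ≡ take window W → List⁺.head w ≡ u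
      head-≡ [ _ ]   eq = ∷-injectiveˡ eq
      head-≡ (_ ∷ _) eq = ∷-injectiveˡ eq

      -- The exchange argument. The tail of the walk is replaced by a stored walk with the same
      -- window and no less slack. Prepending `u` costs both the same, and the new window consists
      -- of `u` and the first `d` entries of the old one, so the windows agree again.
      layer-complete : ∀ l {u W} → Walk u t W → length W ≡ suc l →
                       ∃[ w ] (w ∈ˡ layer l × take window (toList w) ≡ take window W × slack W ≤ slack⁺ w)
      layer-complete zero    [ _ ]       refl = _ , here refl , refl , ≤-refl
      layer-complete zero    (_ ∷ [ _ ]) ()
      layer-complete zero    (_ ∷ _ ∷ _) ()
      layer-complete (suc l) [ _ ]       ()
      layer-complete (suc l) {u} (_∷_ {v = v} {W = W} e r) len
        with w , w∈ , same , le ← layer-complete l r (suc-injective len)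
        with w′ , w′∈ , same′ , le′ ← prune-complete
               (∈-extend⁺ {v = u} w∈ (subst (Adj u) (sym (head-≡ r same)) e))
        = w′ , w′∈ , trans same′ (cong (u ∷_) same-init) , (begin
            slack W ∸ ∣ fresh u (take window W) ∣             ≤⟨ ∸-monoˡ-≤ ∣ fresh u (take window W) ∣ le ⟩
            slack⁺ w ∸ ∣ fresh u (take window W) ∣          ≡⟨ cong (λ us → slack⁺ w ∸ ∣ fresh u us ∣) same ⟨
            slack⁺ (u ∷⁺ w)                                 ≤⟨ le′ ⟩
            slack⁺ w′                                       ∎)
        where
        open ≤-Reasoning
        take-window : ∀ W → take d (take window W) ≡ take d W
        take-window W = trans (take-take d window W) (cong (λ k → take k W) (m≤n⇒m⊓n≡m (n≤1+n d)))

        same-init : take d (toList w) ≡ take d W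
        same-init = trans (sym (take-window (toList w))) (trans (cong (take d) same) (take-window W))

      best-sound : ∀ l {w} → best l ≡ just w → Walk s t (toList w) × length (toList w) ≤ l
      best-sound (suc l) eq with select-sound _ (best l) (layer l) eq
      ... | inj₁ eq′ with r , len ← best-sound l eq′ = r , m≤n⇒m≤1+n len
      ... | inj₂ (w∈ , at-s , _) with r , len ← layer-sound l w∈ =
        subst (λ u → Walk u t _) (≟-true at-s) r , ≤-reflexive len

      at-s : ∀ w → List⁺.head w ≡ s → starts-at-s w ≡ true
      at-s w refl = ≟-refl s

      best-complete : ∀ l {W} → Walk s t W → length W ≤ l → ∃[ w ] (best l ≡ just w × slack W ≤ slack⁺ w)
      best-complete zero    [ _ ]   ()
      best-complete zero    (_ ∷ _) ()
      best-complete (suc l) {W} r len with m≤n⇒m<n∨m≡n len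
      ... | inj₁ (s≤s len′) with w , eq , le ← best-complete l r len′
                            with w′ , eq′ , le′ ← select-≼ starts-at-s (best l) (layer l) eq =
        w′ , eq′ , ≤-trans le le′
      ... | inj₂ len′ with w , w∈ , same , le ← layer-complete l r len′
                      with w′ , eq′ , le′ ← select-complete starts-at-s (best l) w∈ (at-s w (head-≡ r same)) refl =
        w′ , eq′ , ≤-trans le le′

      -- A winner from `layer l` has strictly improved on `best l`, which by `best-complete`
      -- dominates all walks with at most `l` vertices.
      best-first : ∀ l {w W} → best l ≡ just w → Walk s t W → length W < length (toList w) → slack W < slack⁺ w
      best-first (suc l) {w} eq r shorter with select-sound _ (best l) (layer l) eq
      ... | inj₁ eq′ = best-first l eq′ r shorter
      ... | inj₂ (w∈ , _ , improves)
        with _ , len ← layer-sound l w∈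
        with w₀ , eq₀ , le₀ ← best-complete l r (s≤s⁻¹ (≤-trans shorter (≤-reflexive len))) =
        ≤-<-trans le₀ (<ᵇ⇒< (slack⁺ w₀) (slack⁺ w) (subst (λ m → T (better w m)) eq₀ improves))

-- Correctness of the dynamic program

secludedPath : (I : PathInstance) → ℕ → Maybe (List (Fin (PathInstance.n I)))
secludedPath I d = Maybe.map toList (Walks.best graph d s t n)
  where open PathInstance I

-- For `d = 2 + Δ` the window has 3 + Δ vertices, matching the distance in `reduce`. Walks of at
-- most n vertices suffice because a reduct is induced and so repeats no vertex.
secludedPath-correct : ∀ Δ I → MaxDegree≤ Δ I → IsSecludedPath I (secludedPath I (2 + Δ))
secludedPath-correct Δ I degree≤Δ = correct (best n) refl
  where
  open PathInstance I
  open Graph graph using (Cost; IsPath)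
  open Walks graph hiding (best)
  open Reduced

  best = Walks.best graph (2 + Δ) s t
  budget = slack (2 + Δ)

  path⇒walk : ∀ {Q} → IsPath s t Q → Walk s t Q
  path⇒walk p = linked⇒walk linked starts ends
    where open IsPath p

  reduct-short : ∀ {Q} (R : Reduced degree≤Δ s t Q) → length (reduct R) ≤ n
  reduct-short R = unique-length≤n (induced⇒unique (walk R) (induced R))

  n∸Cost≤slack-reduct : ∀ {Q} (R : Reduced degree≤Δ s t Q) → n ∸ Cost Q ≤ budget (reduct R)
  n∸Cost≤slack-reduct R = ≤-trans (∸-monoʳ-≤ n (cost≤ R)) (n∸Cost≤slack (2 + Δ) (reduct R) (spread R))

  correct : ∀ m → best n ≡ m → IsSecludedPath I (Maybe.map toList m)
  correct nothing none = no-path λ Q p → absent (reduce degree≤Δ (path⇒walk p))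
    where
    absent : ∀ {Q} → ¬ Reduced degree≤Δ s t Q
    absent R with _ , eq , _ ← best-complete (2 + Δ) s t n (walk R) (reduct-short R)
             with () ← trans (sym none) eq
  correct (just w) found = optimal
    (record { starts = walk-head route
            ; ends = walk-last route ; linked = walk-linked route ; distinct = unique })
    λ Q p → optimum (reduce degree≤Δ (path⇒walk p))
    where
    W = toList w
    route = proj₁ (best-sound (2 + Δ) s t n found)

    optimum : ∀ {Q} → Reduced degree≤Δ s t Q → Cost W ≤ Cost Q
    optimum {Q} R with w′ , eq , le ← best-complete (2 + Δ) s t n (walk R) (reduct-short R)
                  with refl ← trans (sym found) eq =
      -- The slack of the answer lies between `n ∸ Cost Q` and `n ∸ Cost W`. Cancelling truncated
      -- differences is sound because `Cost W` is at most n.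
      ∸-cancelʳ-≤ (Cost≤n (2 + Δ) W) (≤-trans (n∸Cost≤slack-reduct R) (≤-trans le (slack≤n∸Cost (2 + Δ) W)))

    unique : Unique W
    unique with induced⊎shortcut route
    ... | inj₁ ind = induced⇒unique route ind
    -- The reduct of the shortcut would be strictly shorter than `W` with at least its slack, but
    -- `W` is the first walk of maximal slack.
    ... | inj₂ (W′ , r′ , W′⊆ , W′<) = contradiction
        (best-first (2 + Δ) s t n found (walk R) (≤-<-trans (length≤ R) W′<))
        (≤⇒≯ (≤-trans (slack≤n∸Cost (2 + Δ) W) (≤-trans (∸-monoʳ-≤ n (Cost-mono W′⊆)) (n∸Cost≤slack-reduct R))))
      where R = reduce degree≤Δ r′

-- The dynamic program as a WHILE program

length≤size : ∀ xs → length xs ≤ size (encodeList xs)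
length≤size []       = z≤n
length≤size (x ∷ xs) = s≤s (≤-trans (length≤size xs) (m≤n+m _ (size x)))

-- Table lookup by dropping entries; the default `z` is never reached because the index is below n.
elimList-drop-tabulate : ∀ {n} {A : Set} {z : A} (f : Fin n → A) u →
                         elimList z (λ x _ → x) (drop (toℕ u) (tabulate f)) ≡ f u
elimList-drop-tabulate f zero    = refl
elimList-drop-tabulate f (suc u) = elimList-drop-tabulate (f ∘′ suc) u

tabulate-toℕ : ∀ {A : Set} n (f : ℕ → A) → tabulate {n = n} (f ∘′ toℕ) ≡ applyUpTo f n
tabulate-toℕ zero    f = refl
tabulate-toℕ (suc n) f = cong (f 0 ∷_) (tabulate-toℕ n (f ∘′ suc))

foldr-suc : ∀ {A : Set} (xs : List A) → foldr (λ _ → suc) 0 xs ≡ length xs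
foldr-suc []       = refl
foldr-suc (_ ∷ xs) = cong suc (foldr-suc xs)

length-concatMap-≤ : ∀ {A B : Set} (f : A → List B) {c} → (∀ x → length (f x) ≤ c) →
                     ∀ xs → length (concatMap f xs) ≤ length xs * c
length-concatMap-≤ f f≤ []       = z≤n
length-concatMap-≤ f f≤ (x ∷ xs) =
  ≤-trans (≤-reflexive (length-++ (f x))) (+-mono-≤ (f≤ x) (length-concatMap-≤ f f≤ xs))

does-≟-∸ : ∀ {n} (u v : Fin n) →
           not (0 <ᵇ toℕ u ∸ toℕ v) ∧ not (0 <ᵇ toℕ v ∸ toℕ u) ≡ does (u Fin.≟ v)
does-≟-∸ zero    zero    = refl
does-≟-∸ zero    (suc v) = refl
does-≟-∸ (suc u) zero    = refl
does-≟-∸ (suc u) (suc v) = does-≟-∸ u v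

lookup-⁅⁆ : ∀ {n} (u v : Fin n) → does (u Fin.≟ v) ≡ lookup ⁅ u ⁆ v
lookup-⁅⁆ zero    zero    = refl
lookup-⁅⁆ zero    (suc v) = sym (lookup-replicate v false)
lookup-⁅⁆ (suc u) zero    = refl
lookup-⁅⁆ (suc u) (suc v) = lookup-⁅⁆ u v

-- Each member of `p` costs one `pred`, so the subtraction is carried out without computing the
-- cardinality.
foldl-∸ : ∀ {n} {A : Set} (p : Subset n) (f : Fin n → A) (inside? : A → Bool) →
          (∀ i → inside? (f i) ≡ lookup p i) → ∀ r →
          foldl (λ r x → Bool.if inside? x then pred r else r) r (tabulate f) ≡ r ∸ ∣ p ∣
foldl-∸ [] f inside? eq r = refl
foldl-∸ (b ∷ p) f inside? eq r with inside? (f zero) | eq zero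
foldl-∸ (false ∷ p) f inside? eq r | _ | refl = foldl-∸ p (f ∘′ suc) inside? (λ i → eq (suc i)) r
foldl-∸ (true  ∷ p) f inside? eq r | _ | refl =
  trans (foldl-∸ p (f ∘′ suc) inside? (λ i → eq (suc i)) (pred r)) (pred∸ r ∣ p ∣)
  where
  pred∸ : ∀ r k → pred r ∸ k ≡ r ∸ suc k
  pred∸ zero    k = 0∸n≡0 k
  pred∸ (suc r) k = refl

-- Reading the graph from the instance

open SearchProblem SecludedPath using (encodeInstance)
open Computation encodeInstance

vertexCount : PathInstance → ℕ
vertexCount = PathInstance.n

rows : ∀ i → List (List Bool)
rows i = tabulate λ u → tabulate λ v → adj u v
  where open Graph (PathInstance.graph i)

length-rows : ∀ i → length (rows i) ≡ vertexCount i
length-rows i = length-tabulate _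

poly-n : Poly vertexCount
poly-n = poly-≤ n≤weight poly-weight
  where
  n≤weight : ∀ i → vertexCount i ≤ weight i
  n≤weight i = begin
    vertexCount i              ≡⟨ length-tabulate (λ u → encodeList (tabulate λ v → encodeBool (adj u v))) ⟨
    length (tabulate λ u → encodeList (tabulate λ v → encodeBool (adj u v)))
                               ≤⟨ length≤size (tabulate λ u → encodeList (tabulate λ v → encodeBool (adj u v))) ⟩
    size (encodeGraph graph)   ≤⟨ m≤m+n _ _ ⟩
    size (encodeGraph graph) + size (cons (encodeVertex s) (encodeVertex t))
                               ≤⟨ n≤1+n _ ⟩
    weight i                   ∎
    where
    open ≤-Reasoning
    open PathInstance i
    open Graph graph

Vertices : Rep
Value  Vertices i = Fin (vertexCount i)
encode Vertices   = encodeVertex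

Input : Rep
Value  Input _     = ⊤
encode Input {i} _ = encodeInstance i

inputᵗ : ∀ {Γ} → Γ ⊢ Input ∋ λ _ _ → tt
inputᵗ {[]}    = term id (poly-const 1) λ i ρ → exactly id
inputᵗ {R ∷ Γ} = weaken inputᵗ

partsᵗ : ∀ {Γ} → Γ ⊢ Pairs (Lists (Lists Bools)) (Pairs Vertices Vertices) ∋
         λ i _ → rows i , PathInstance.s i , PathInstance.t i
partsᵗ = recode (λ i _ → cong (λ g → cons g (ends i)) (cong encodeList (graph-rows i))) inputᵗ
  where
  ends : PathInstance → Tree
  ends i = cons (encodeVertex s) (encodeVertex t)
    where open PathInstance i

  graph-rows : ∀ i → let open Graph (PathInstance.graph i) using (adj) in
                     tabulate (λ u → encodeList (tabulate λ v → encodeBool (adj u v)))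
                     ≡ map (encodeList ∘′ map encodeBool) (rows i)
  graph-rows i = sym (trans (map-tabulate (λ u → tabulate (adj u)) (encodeList ∘′ map encodeBool))
                            (tabulate-cong λ u → cong encodeList (map-tabulate (adj u) encodeBool)))
    where open Graph (PathInstance.graph i) using (adj)

rowsᵗ : ∀ {Γ} → Γ ⊢ Lists (Lists Bools) ∋ λ i _ → rows i
rowsᵗ = first partsᵗ

sourceᵗ : ∀ {Γ} → Γ ⊢ Vertices ∋ λ i _ → PathInstance.s i
sourceᵗ = first (second partsᵗ)

targetᵗ : ∀ {Γ} → Γ ⊢ Vertices ∋ λ i _ → PathInstance.t i
targetᵗ = second (second partsᵗ)

-- The state of the loop that lists the vertices is determined by its counter.
Countdowns : Rep
Value  Countdowns _ = ℕ
encode Countdowns k = cons (encodeℕ k) (encodeList (map encodeℕ (downFrom k)))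

countdown-parts : ∀ {Γ k} → Γ ⊢ Countdowns ∋ k →
                  Γ ⊢ Pairs Numbers (Lists Numbers) ∋ λ i ρ → k i ρ , downFrom (k i ρ)
countdown-parts = recode λ _ _ → refl

-- The number of vertices is not written in the input; it is found by counting the rows of the
-- adjacency matrix.
countdownᵗ : ∀ {Γ} → Γ ⊢ Countdowns ∋ λ i _ → vertexCount i
countdownᵗ = ext (λ i _ → trans (foldr-suc (rows i)) (length-rows i))
  (foldrᵗ rowsᵗ (bounded poly-n λ i _ → ≤-reflexive (length-rows i))
    (construct {R = Numbers} {S = Lists Numbers} (λ _ _ → refl) zeroᵗ nilᵗ)
    (construct {S = Lists Numbers} (λ _ _ → refl)
      (sucᵗ (first (countdown-parts var)))
      (consᵗ (first (countdown-parts var)) (second (countdown-parts var)))))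

countᵗ : ∀ {Γ} → Γ ⊢ Numbers ∋ λ i _ → vertexCount i
countᵗ = first (countdown-parts countdownᵗ)

verticesᵗ : ∀ {Γ} → Γ ⊢ Lists Vertices ∋ λ i _ → allFin (vertexCount i)
verticesᵗ = recode (λ i _ → cong encodeList (eq (vertexCount i)))
  (reverseᵗ (second (countdown-parts countdownᵗ))
            (bounded poly-n λ i _ → ≤-reflexive (length-downFrom (vertexCount i))))
  where
  eq : ∀ n → map encodeℕ (reverse (downFrom n)) ≡ map encodeVertex (allFin n)
  eq n = begin
    map encodeℕ (reverse (downFrom n))   ≡⟨ cong (map encodeℕ) (reverse-downFrom n) ⟩
    map encodeℕ (upTo n)                 ≡⟨ cong (map encodeℕ) (tabulate-toℕ n Function.id) ⟨
    map encodeℕ (tabulate toℕ)           ≡⟨ cong (map encodeℕ) (map-tabulate Function.id toℕ) ⟨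
    map encodeℕ (map toℕ (allFin n))     ≡⟨ map-∘ (allFin n) ⟨
    map encodeVertex (allFin n)          ∎
    where open ≡-Reasoning

allFin-bounded : ∀ {Γ} → Bounded Γ λ i _ → length (allFin (vertexCount i))
allFin-bounded = bounded poly-n λ i _ → ≤-reflexive (length-tabulate Function.id)

indexᵗ : ∀ {Γ u} → Γ ⊢ Vertices ∋ u → Γ ⊢ Numbers ∋ λ i ρ → toℕ (u i ρ)
indexᵗ = recode λ _ _ → refl

index-bounded : ∀ {Γ} {u : ∀ i → Env Γ i → Fin (vertexCount i)} → Bounded Γ λ i ρ → toℕ (u i ρ)
index-bounded {u = u} = bounded poly-n λ i ρ → <⇒≤ (Fin.toℕ<n (u i ρ))

adjᵗ : ∀ {Γ u v} → Γ ⊢ Vertices ∋ u → Γ ⊢ Vertices ∋ v →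
       Γ ⊢ Bools ∋ λ i ρ → Graph.adj (PathInstance.graph i) (u i ρ) (v i ρ)
adjᵗ {Γ} {u} {v} tu tv = ext entry
  (caseList (dropᵗ (indexᵗ tv) index-bounded
              (caseList (dropᵗ (indexᵗ tu) index-bounded rowsᵗ) nilᵗ (weaken var)))
            falseᵗ (weaken var))
  where
  entry : ∀ i ρ → elimList false (λ b _ → b) (drop (toℕ (v i ρ))
            (elimList [] (λ row _ → row) (drop (toℕ (u i ρ)) (rows i)))) ≡
          Graph.adj (PathInstance.graph i) (u i ρ) (v i ρ)
  entry i ρ = trans (cong (λ row → elimList false (λ b _ → b) (drop (toℕ (v i ρ)) row))
                          (elimList-drop-tabulate {z = []} (λ u → tabulate (adj u)) (u i ρ)))
                    (elimList-drop-tabulate (adj (u i ρ)) (v i ρ))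
    where open Graph (PathInstance.graph i) using (adj)

equalᵗ : ∀ {Γ u v} → Γ ⊢ Vertices ∋ u → Γ ⊢ Vertices ∋ v → Γ ⊢ Bools ∋ λ i ρ → does (u i ρ Fin.≟ v i ρ)
equalᵗ {u = u} {v} tu tv = ext (λ i ρ → does-≟-∸ (u i ρ) (v i ρ))
  (andᵗ (notᵗ (positiveᵗ (monusᵗ (indexᵗ tu) (indexᵗ tv) index-bounded)))
        (notᵗ (positiveᵗ (monusᵗ (indexᵗ tv) (indexᵗ tu) index-bounded))))

module _ (i : PathInstance) where
  open Graph (PathInstance.graph i) public using () renaming (N[_] to N)
  open Walks (PathInstance.graph i) public using (cover)

inNᵗ : ∀ {Γ u v} → Γ ⊢ Vertices ∋ u → Γ ⊢ Vertices ∋ v → Γ ⊢ Bools ∋ λ i ρ → lookup (N i (u i ρ)) (v i ρ)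
inNᵗ {u = u} {v} tu tv = ext (λ i ρ → sym (eq i (u i ρ) (v i ρ))) (orᵗ (equalᵗ tu tv) (adjᵗ tu tv))
  where
  eq : ∀ i u v → lookup (N i u) v ≡ does (u Fin.≟ v) ∨ Graph.adj (PathInstance.graph i) u v
  eq i u v = trans (lookup-zipWith _∨_ v ⁅ u ⁆ (Graph.neighbours (PathInstance.graph i) u))
                   (cong₂ _∨_ (sym (lookup-⁅⁆ u v)) (lookup∘tabulate (Graph.adj (PathInstance.graph i) u) v))

coveredᵗ : ∀ {Γ us v} → Γ ⊢ Lists Vertices ∋ us → Bounded Γ (λ i ρ → length (us i ρ)) → Γ ⊢ Vertices ∋ v →
           Γ ⊢ Bools ∋ λ i ρ → lookup (cover i (us i ρ)) (v i ρ)
coveredᵗ {us = us} {v} tus len tv = ext (λ i ρ → eq i (us i ρ) (v i ρ))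
  (foldrᵗ tus len falseᵗ (orᵗ (inNᵗ (weaken var) (weaken (weaken tv))) var))
  where
  eq : ∀ i us v → foldr (λ u b → lookup (N i u) v ∨ b) false us ≡ lookup (cover i us) v
  eq i []       v = sym (lookup-replicate v false)
  eq i (u ∷ us) v = trans (cong (lookup (N i u) v ∨_) (eq i us v))
                          (sym (lookup-zipWith _∨_ v (N i u) (cover i us)))

-- Routes, layers and the main loop

module _ (d : ℕ) where

  module _ (i : PathInstance) where
    open Walks (PathInstance.graph i)
    open PathInstance i

    freshOf    = fresh d
    slackOf    = slack d
    selectOf   = select d
    agreeOf    = agree d
    keysOf     = keys d
    extendOf   = extend d
    pruneOf    = prune d
    layerOf    = layer d s t
    bestOf     = best d s t

  width : ℕ
  width = suc d

  chargeᵗ : ∀ {Γ v us r} → Γ ⊢ Vertices ∋ v → Γ ⊢ Lists Vertices ∋ us → Bounded Γ (λ i ρ → length (us i ρ)) →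
            Γ ⊢ Numbers ∋ r → Γ ⊢ Numbers ∋ λ i ρ → r i ρ ∸ ∣ freshOf i (v i ρ) (us i ρ) ∣
  chargeᵗ {v = v} {us} {r} tv tus len tr =
    ext (λ i ρ → foldl-∸ (freshOf i (v i ρ) (us i ρ)) Function.id _ (eq i ρ) (r i ρ))
      (foldlᵗ verticesᵗ allFin-bounded tr
        (ifᵗ (andᵗ (inNᵗ (weaken (weaken tv)) (weaken var))
                   (notᵗ (coveredᵗ (weaken (weaken tus))
                      (bounded (limit-poly len) λ i ρ → ≤-limit len i (proj₁ (proj₁ ρ))) (weaken var))))
             (predᵗ var) var))
    where
    open Bounded
    eq : ∀ i ρ y → lookup (N i (v i ρ)) y ∧ not (lookup (cover i (us i ρ)) y) ≡
                 lookup (freshOf i (v i ρ) (us i ρ)) y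
    eq i ρ y = sym (trans (lookup-zipWith _∧_ y (N i (v i ρ)) (∁ (cover i (us i ρ))))
                          (cong (lookup (N i (v i ρ)) y ∧_) (lookup-map y not (cover i (us i ρ)))))

  -- A walk carries its slack along, so that extending it costs one window.
  Routes : Rep
  Value  Routes i     = List⁺ (Fin (vertexCount i))
  encode Routes {i} r = cons (encodeℕ (slackOf i (toList r))) (encodeList (map encodeVertex (toList r)))

  route-parts : ∀ {Γ r} → Γ ⊢ Routes ∋ r →
                Γ ⊢ Pairs Numbers (Lists Vertices) ∋ λ i ρ → slackOf i (toList (r i ρ)) , toList (r i ρ)
  route-parts = recode λ _ _ → refl

  slackᵗ : ∀ {Γ r} → Γ ⊢ Routes ∋ r → Γ ⊢ Numbers ∋ λ i ρ → slackOf i (toList (r i ρ))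
  slackᵗ t = first (route-parts t)

  listᵗ : ∀ {Γ r} → Γ ⊢ Routes ∋ r → Γ ⊢ Lists Vertices ∋ λ i ρ → toList (r i ρ)
  listᵗ t = second (route-parts t)

  headᵗ : ∀ {Γ r} → Γ ⊢ Routes ∋ r → Γ ⊢ Vertices ∋ λ i ρ → List⁺.head (r i ρ)
  headᵗ {r = r} t = first
    (recode {S = Pairs Vertices (Lists Vertices)} {g = λ i ρ → List⁺.head (r i ρ) , List⁺.tail (r i ρ)}
            (λ _ _ → refl) (listᵗ t))

  startᵗ : ∀ {Γ v} → Γ ⊢ Vertices ∋ v → Γ ⊢ Routes ∋ λ i ρ → v i ρ ∷ []
  startᵗ tv = construct {S = Lists Vertices} (λ _ _ → refl)
    (chargeᵗ tv nilᵗ (bounded (poly-const 0) λ _ _ → z≤n) countᵗ)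
    (consᵗ tv nilᵗ)

  pushᵗ : ∀ {Γ v r} → Γ ⊢ Vertices ∋ v → Γ ⊢ Routes ∋ r → Γ ⊢ Routes ∋ λ i ρ → v i ρ ∷⁺ r i ρ
  pushᵗ {v = v} {r} tv tr = construct {S = Lists Vertices} (λ _ _ → refl)
    (chargeᵗ tv (takeᵗ width (listᵗ tr))
      (bounded (poly-const width) λ i ρ →
        ≤-trans (≤-reflexive (length-take width (toList (r i ρ)))) (m⊓n≤m width _))
      (slackᵗ tr))
    (consᵗ tv (listᵗ tr))

  selectᵗ : ∀ {Γ p m rs} → Routes ∷ Γ ⊢ Bools ∋ p → Γ ⊢ Maybes Routes ∋ m →
            Γ ⊢ Lists Routes ∋ rs → Bounded Γ (λ i ρ → length (rs i ρ)) →
            Γ ⊢ Maybes Routes ∋ λ i ρ → selectOf i (λ r → p i (ρ , r)) (m i ρ) (rs i ρ)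
  selectᵗ tp tm trs len = foldrᵗ trs len tm
    (ifᵗ (andᵗ (weaken tp)
               (caseMaybe var trueᵗ
                 (lessThanᵗ (slackᵗ var)
                   (bounded poly-n λ i ρ → Walks.slack≤n (PathInstance.graph i) d (toList (proj₂ ρ)))
                   (slackᵗ (weaken (weaken var))))))
         (justᵗ (weaken var)) var)

  agreeᵗ : ∀ k {Γ us vs} → Γ ⊢ Lists Vertices ∋ us → Γ ⊢ Lists Vertices ∋ vs →
           Γ ⊢ Bools ∋ λ i ρ → agreeOf i k (us i ρ) (vs i ρ)
  agreeᵗ zero    tus tvs = trueᵗ
  agreeᵗ (suc k) {us = us} {vs} tus tvs = ext (λ i ρ → eq i (us i ρ) (vs i ρ))
    (caseList tus (caseList tvs trueᵗ falseᵗ)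
      (caseList (weaken (weaken tvs)) falseᵗ
        (andᵗ (equalᵗ (weaken (weaken (weaken var))) (weaken var)) (agreeᵗ k (weaken (weaken var)) var))))
    where
    eq : ∀ i us vs → elimList (elimList true (λ _ _ → false) vs)
           (λ u us → elimList false (λ v vs → does (u Fin.≟ v) ∧ agreeOf i k us vs) vs) us ≡
                     agreeOf i (suc k) us vs
    eq i []       []       = refl
    eq i []       (_ ∷ _)  = refl
    eq i (_ ∷ _)  []       = refl
    eq i (_ ∷ _)  (_ ∷ _)  = refl

  keyLimit : ℕ → PathInstance → ℕ
  keyLimit zero    i = 1
  keyLimit (suc k) i = 1 + vertexCount i * keyLimit k i

  -- The degree grows with `k`, so a uniform polynomial bound needs a constant width.
  keyLimit-poly : ∀ k → Poly (keyLimit k)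
  keyLimit-poly zero    = poly-const 1
  keyLimit-poly (suc k) = poly-+ (poly-const 1) (poly-* poly-n (keyLimit-poly k))

  length-keys : ∀ k i → length (keysOf i k) ≤ keyLimit k i
  length-keys zero    i = ≤-refl
  length-keys (suc k) i = s≤s (≤-trans
    (length-concatMap-≤ prepend
      (λ v → ≤-trans (≤-reflexive (length-map (v ∷_) (keysOf i k))) (length-keys k i))
      (allFin (vertexCount i)))
    (≤-reflexive (cong (_* keyLimit k i) (length-tabulate {n = vertexCount i} Function.id))))
    where
    prepend : Fin (vertexCount i) → List (List (Fin (vertexCount i)))
    prepend v = map (v ∷_) (keysOf i k)

  keysᵗ : ∀ k {Γ} → Γ ⊢ Lists (Lists Vertices) ∋ λ i _ → keysOf i k
  keysᵗ zero    = consᵗ nilᵗ nilᵗ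
  keysᵗ (suc k) = consᵗ nilᵗ
    (concatMapᵗ verticesᵗ allFin-bounded
      (mapᵗ (keysᵗ k) (bounded (keyLimit-poly k) λ i _ → length-keys k i) (consᵗ (weaken var) var))
      (bounded (keyLimit-poly k) λ i ρ → ≤-trans (≤-reflexive (length-map _ (keysOf i k))) (length-keys k i)))

  length-if : ∀ {A : Set} b (x : A) → length (Bool.if b then x ∷ [] else []) ≤ 1
  length-if false x = z≤n
  length-if true  x = ≤-refl

  length-fromMaybe : ∀ {A : Set} (m : Maybe A) → length (fromMaybe m) ≤ 1
  length-fromMaybe nothing  = z≤n
  length-fromMaybe (just _) = ≤-refl

  successors : ∀ i → List⁺ (Fin (vertexCount i)) → List (List⁺ (Fin (vertexCount i)))
  successors i r =
    concatMap (λ v → Bool.if adj v (List⁺.head r) then (v ∷⁺ r) ∷ [] else []) (allFin (vertexCount i))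
    where open Graph (PathInstance.graph i) using (adj)

  length-successors : ∀ i r → length (successors i r) ≤ vertexCount i
  length-successors i r = ≤-trans
    (length-concatMap-≤ _ (λ v → length-if (adj v (List⁺.head r)) (v ∷⁺ r)) (allFin (vertexCount i)))
    (≤-reflexive (trans (*-identityʳ _) (length-tabulate Function.id)))
    where open Graph (PathInstance.graph i) using (adj)

  extendᵗ : ∀ {Γ rs} → Γ ⊢ Lists Routes ∋ rs → Bounded Γ (λ i ρ → length (rs i ρ)) →
            Γ ⊢ Lists Routes ∋ λ i ρ → extendOf i (rs i ρ)
  extendᵗ trs len = concatMapᵗ trs len
    (concatMapᵗ verticesᵗ allFin-bounded
      (ifᵗ (adjᵗ var (headᵗ (weaken var))) (consᵗ (pushᵗ var (weaken var)) nilᵗ) nilᵗ)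
      (bounded (poly-const 1) λ i ((_ , r) , v) →
        length-if (Graph.adj (PathInstance.graph i) v (List⁺.head r)) (v ∷⁺ r)))
    (bounded poly-n λ i ρ → length-successors i (proj₂ ρ))

  fromMaybeᵗ : ∀ {Γ R m} → Γ ⊢ Maybes R ∋ m → Γ ⊢ Lists R ∋ λ i ρ → fromMaybe (m i ρ)
  fromMaybeᵗ {m = m} tm = ext (λ i ρ → eq (m i ρ)) (caseMaybe tm nilᵗ (consᵗ var nilᵗ))
    where
    eq : ∀ {A : Set} (m : Maybe A) → maybe′ (_∷ []) [] m ≡ fromMaybe m
    eq nothing  = refl
    eq (just _) = refl

  pruneᵗ : ∀ {Γ rs} → Γ ⊢ Lists Routes ∋ rs → Bounded Γ (λ i ρ → length (rs i ρ)) →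
           Γ ⊢ Lists Routes ∋ λ i ρ → pruneOf i (rs i ρ)
  pruneᵗ {rs = rs} trs len = concatMapᵗ
    (keysᵗ width) (bounded (keyLimit-poly width) λ i _ → length-keys width i)
    (fromMaybeᵗ (selectᵗ (agreeᵗ width (weaken var) (listᵗ var)) nothingᵗ (weaken trs)
      (bounded (limit-poly len) λ i ρ → ≤-limit len i (proj₁ ρ))))
    (bounded (poly-const 1) λ i (ρ , key) →
      length-fromMaybe (selectOf i (λ r → agreeOf i width key (toList r)) nothing (rs i ρ)))
    where open Bounded

  length-prune : ∀ i rs → length (pruneOf i rs) ≤ keyLimit width i
  length-prune i rs = ≤-trans
    (length-concatMap-≤ (λ key → fromMaybe (selectOf i (λ r → agreeOf i width key (toList r)) nothing rs))
                        (λ key → length-fromMaybe (selectOf i (λ r → agreeOf i width key (toList r)) nothing rs))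
                        (keysOf i width))
    (≤-trans (≤-reflexive (*-identityʳ _)) (length-keys width i))

  -- Pruning leaves at most one walk per key, so the size of a layer does not depend on that of the
  -- preceding one and cannot build up over the rounds.
  length-layer : ∀ l i → length (layerOf i l) ≤ 1 + keyLimit width i
  length-layer zero    i = s≤s z≤n
  length-layer (suc l) i = m≤n⇒m≤1+n (length-prune i (extendOf i (layerOf i l)))

  layer-poly : Poly λ i → 1 + keyLimit width i
  layer-poly = poly-+ (poly-const 1) (keyLimit-poly width)

  -- The state of the main loop is likewise determined by its counter.
  Stages : Rep
  Value  Stages _     = ℕ
  encode Stages {i} l =
    cons (encode (Lists Routes) {i} (layerOf i l)) (encode (Maybes Routes) {i} (bestOf i l))

  stage-parts : ∀ {Γ l} → Γ ⊢ Stages ∋ l →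
                Γ ⊢ Pairs (Lists Routes) (Maybes Routes) ∋ λ i ρ → layerOf i (l i ρ) , bestOf i (l i ρ)
  stage-parts = recode λ _ _ → refl

  nextᵗ : ∀ {Γ l} → Γ ⊢ Stages ∋ l → Γ ⊢ Stages ∋ λ i ρ → suc (l i ρ)
  nextᵗ {l = l} t = construct {R = Lists Routes} {S = Maybes Routes} (λ _ _ → refl)
    (pruneᵗ (extendᵗ (first (stage-parts t)) (bounded layer-poly λ i ρ → length-layer (l i ρ) i))
      (bounded (poly-* layer-poly poly-n) λ i ρ → ≤-trans
        (length-concatMap-≤ (successors i) (length-successors i) (layerOf i (l i ρ)))
        (*-monoˡ-≤ (vertexCount i) (length-layer (l i ρ) i))))
    (selectᵗ (equalᵗ (headᵗ var) sourceᵗ) (second (stage-parts t)) (first (stage-parts t))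
      (bounded layer-poly λ i ρ → length-layer (l i ρ) i))

  finalᵗ : [] ⊢ Stages ∋ λ i _ → vertexCount i
  finalᵗ = ext (λ i _ → trans (foldr-suc (allFin (vertexCount i))) (length-tabulate Function.id))
    (foldrᵗ verticesᵗ allFin-bounded
      (construct {R = Lists Routes} {S = Maybes Routes} (λ _ _ → refl)
        (consᵗ (startᵗ targetᵗ) nilᵗ) nothingᵗ)
      (nextᵗ var))

  Answers : Rep
  Value  Answers = SearchProblem.Answer SecludedPath
  encode Answers = encodeMaybePath

  abstract
    secludedPathᵗ : [] ⊢ Answers ∋ λ i _ → secludedPath i d
    secludedPathᵗ = recode (λ i _ → eq i (bestOf i (vertexCount i)))
      (caseMaybe {S = Maybes (Lists Vertices)} (second (stage-parts finalᵗ)) nothingᵗ (justᵗ (listᵗ var)))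
      where
      eq : ∀ i m → encode (Maybes (Lists Vertices)) {i} (maybe′ (λ r → just (toList r)) nothing m) ≡
                   encodeMaybePath (Maybe.map toList m)
      eq i nothing  = refl
      eq i (just _) = refl

theorem4 : (Δ : ℕ) → PolyTimeSolvableOn SecludedPath (MaxDegree≤ Δ)
theorem4 Δ = program , coefficient , degree , λ I degree≤Δ →
  let k , run , k≤ = runs I tt in
  secludedPath I (2 + Δ) , k , run , ≤-trans k≤ (≤-trans (bound I) (m≤m+n _ _)) ,
  secludedPath-correct Δ I degree≤Δ
  where
  open _⊢_∋_ (secludedPathᵗ (2 + Δ))
  open Poly steps-poly
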